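{- Let $s(7,n)$ be the number of spanning trees of the $7\times n$ grid graph $G_7(n)$ for $n\ge 1$, and let $s(7,0)=0$. Then, as formal power series in $t$, $$\sum_{n=0}^{\infty} s(7,n)\,t^n=\frac{N_7(t)}{D_7(t)},$$ where $$ \begin{aligned} N_7 ={}& -t^{47}-142\,t^{46}+661245\,t^{45}-279917500\,t^{44}+53184503243\,t^{43}-5570891154842\,t^{42}\\ &+341638600598298\,t^{41}-11886702497030032\,t^{40}+164458937576610742\,t^{39}\\ &+4371158470492451828\,t^{38}-288737344956855301342\,t^{37}+7736513993329973661368\,t^{36}\\ &-131582338768322853956994\,t^{35}+1573202877300834187134466\,t^{34}\\ &-13805721749199518460916737\,t^{33}+90975567796174070740787232\,t^{32}\\ &-455915282590547643587452175\,t^{31}+1747901867578637315747826286\,t^{30}\\ &-5126323837327170557921412877\,t^{29}+11416779122947828869806142972\,t^{28}\\ &-18924703166237080216745900796\,t^{27}+22194247945745188489023284104\,t^{26}\\ &-15563815847174688069871470516\,t^{25}+15563815847174688069871470516\,t^{23}\\ &-22194247945745188489023284104\,t^{22}+18924703166237080216745900796\,t^{21}\\ &-11416779122947828869806142972\,t^{20}+5126323837327170557921412877\,t^{19}\\ &-1747901867578637315747826286\,t^{18}+455915282590547643587452175\,t^{17}\\ &-90975567796174070740787232\,t^{16}+13805721749199518460916737\,t^{15}\\ &-1573202877300834187134466\,t^{14}+131582338768322853956994\,t^{13}-7736513993329973661368\,t^{12}\\ &+288737344956855301342\,t^{11}-4371158470492451828\,t^{10}-164458937576610742\,t^{9}\\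 &+11886702497030032\,t^{8}-341638600598298\,t^{7}+5570891154842\,t^{6}-53184503243\,t^{5}\\ &+279917500\,t^{4}-661245\,t^{3}+142\,t^{2}+t \end{aligned} $$ and $$ \begin{aligned} D_7 ={}& t^{48}-2769\,t^{47}+2630641\,t^{46}-1195782497\,t^{45}+305993127089\,t^{44}-48551559344145\,t^{43}\\ &+5083730101530753\,t^{42}-366971376492201338\,t^{41}+18871718211768417242\,t^{40}\\ &-709234610141846974874\,t^{39}+19874722637854592209338\,t^{38}-422023241997789381263002\,t^{37}\\ &+6880098547452856483997402\,t^{36}-87057778313447181201990522\,t^{35}\\ &+862879164715733847737203343\,t^{34}-6750900711491569851736413311\,t^{33}\\ &+41958615314622858303912597215\,t^{32}-208258356862493902206466194607\,t^{31}\\ &+828959040281722890327985220255\,t^{30}-2654944041424536277948746010303\,t^{29}\\ &+6859440538554030239641036025103\,t^{28}-14324708604336971207868317957868\,t^{27}\\ &+24214587194571650834572683444012\,t^{26}-33166490975387358866518005011884\,t^{25}\\ &+36830850383375837481096026357868\,t^{24}-33166490975387358866518005011884\,t^{23}\\ &+24214587194571650834572683444012\,t^{22}-14324708604336971207868317957868\,t^{21}\\ &+6859440538554030239641036025103\,t^{20}-2654944041424536277948746010303\,t^{19}\\ &+828959040281722890327985220255\,t^{18}-208258356862493902206466194607\,t^{17}\\ &+41958615314622858303912597215\,t^{16}-6750900711491569851736413311\,t^{15}\\ &+862879164715733847737203343\,t^{14}-87057778313447181201990522\,t^{13}\\ &+6880098547452856483997402\,t^{12}-422023241997789381263002\,t^{11}\\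 &+19874722637854592209338\,t^{10}-709234610141846974874\,t^{9}+18871718211768417242\,t^{8}\\ &-366971376492201338\,t^{7}+5083730101530753\,t^{6}-48551559344145\,t^{5}+305993127089\,t^{4}\\ &-1195782497\,t^{3}+2630641\,t^{2}-2769\,t+1. \end{aligned} $$
   Context: For positive integers $k,n$, the $k\times n$ grid graph $G_k(n)$ has vertex set $\{v_{ij} : 1\le i\le k,\ 1\le j\le n\}$, and $\{v_{ij},v_{i'j'}\}$ is an edge if and only if $|i-i'|+|j-j'|=1$. A spanning tree of a graph is a subset of its edges forming a tree on all of its vertices (labeled count, no identification under symmetry). -}

module Defs where

import Algebra.Properties.CommutativeMonoid.Sum as FinSum
open import Data.Empty using (⊥-elim)
open import Data.Fin.Base as Fin using (Fin; zero; suc; toℕ; remQuot)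
open import Data.Fin.Properties as Fin using (_≟_; _<?_; all?; any?; injective⇒≤)
open import Data.Fin.Subset using (Subset; _∈_; inside; outside)
open import Data.Fin.Subset.Properties using (_∈?_)
open import Data.Integer.Base as ℤ using (ℤ; +_; -_)
import Data.Integer.Properties as ℤ
open import Data.List.Base
  using (List; []; _∷_; _++_; map; filter; length; lookup; head; last; allFin; cartesianProduct)
open import Data.List.Membership.Propositional.Properties using (∈-lookup; ∈-filter⁻)
open import Data.List.Relation.Unary.All as All using (All)
open import Data.List.Relation.Unary.AllPairs using (_∷_)
open import Data.List.Relation.Unary.Linked using (Linked; linked?)
open import Data.List.Relation.Unary.Unique.Propositional using (Unique)
import Data.List.Relation.Unary.Unique.DecPropositional as UniqueDec
open import Data.Maybe.Base using (just)
open import Data.Maybe.Properties using (≡-dec)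
open import Data.Nat.Base as ℕ using (ℕ; zero; suc; _≤_; z≤n; s≤s; _+_; _*_; _∸_; ∣_-_∣)
import Data.Nat.Properties as ℕ
open import Data.Product using (Σ-syntax; ∃; ∃-syntax; ∃₂; _×_; _,_; proj₁; proj₂)
import Data.Product.Properties as Product
open import Data.Sum.Base as Sum using (_⊎_; inj₁; inj₂)
open import Data.Vec.Base as Vec using ([]; _∷_)
open import Function.Base using (_∘_)
open import Level using (0ℓ)
open import Relation.Binary.Core using (Rel)
open import Relation.Binary.Definitions using (Decidable; Symmetric)
open import Relation.Binary.PropositionalEquality
  using (_≡_; _≗_; refl; sym; trans; cong; cong₂; subst)
open import Relation.Nullary.Decidable using (Dec; yes; no; map′; ¬?; _×-dec_; _⊎-dec_)
open import Relation.Nullary.Negation using (¬_)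
open import Relation.Unary as Unary using (Pred)

private
  variable
    m : ℕ

------------------------------------------------------------------------
-- Finite simple graphs

record SimpleGraph (m : ℕ) : Set₁ where
  infix 4 _~_ _~?_
  field
    _~_      : Rel (Fin m) 0ℓ
    _~?_     : Decidable _~_
    ~-sym    : Symmetric _~_
    ~-irrefl : ∀ {u} → ¬ (u ~ u)

module _ (G : SimpleGraph m) where
  open SimpleGraph G

  -- The vertex sequence of a path from u to v; vertices do not repeat.
  IsPath : Fin m → Fin m → Pred (List (Fin m)) 0ℓ
  IsPath u v p = Linked _~_ p × Unique p × head p ≡ just u × last p ≡ just v

  Connected : Set
  Connected = ∀ u v → ∃[ p ] IsPath u v p

  -- A cycle is a path on at least three vertices whose ends are adjacent.
  IsCycle : Pred (List (Fin m)) 0ℓ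
  IsCycle c = 3 ≤ length c × (∃₂ λ u v → IsPath u v c × v ~ u)

  Acyclic : Set
  Acyclic = ¬ (∃[ c ] IsCycle c)

  IsTree : Set
  IsTree = Connected × Acyclic

  -- Each edge {u , v} is listed once, oriented so that u < v.
  edges : List (Fin m × Fin m)
  edges = filter (λ (u , v) → (u <? v) ×-dec (u ~? v))
                 (cartesianProduct (allFin m) (allFin m))

  EdgeSet : Set
  EdgeSet = Subset (length edges)

-- The graph on all vertices of G whose edges are those in F.
spanningSubgraph : (G : SimpleGraph m) → EdgeSet G → SimpleGraph m
spanningSubgraph {m} G F = record
  { _~_      = _~_
  ; _~?_     = λ u v → any? λ e → (e ∈? F) ×-dec (edge e ≟ₑ (u , v) ⊎-dec edge e ≟ₑ (v , u))
  ; ~-sym    = λ (e , e∈F , ends) → e , e∈F , Sum.swap ends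
  ; ~-irrefl = λ (e , _ , ends) → irrefl e (Sum.reduce ends)
  }
  where
  open SimpleGraph G using () renaming (_~?_ to _~G?_)

  edge : Fin (length (edges G)) → Fin m × Fin m
  edge = lookup (edges G)

  _≟ₑ_ : Decidable {A = Fin m × Fin m} _≡_
  _≟ₑ_ = Product.≡-dec _≟_ _≟_

  _~_ : Rel (Fin m) 0ℓ
  u ~ v = ∃[ e ] e ∈ F × (edge e ≡ (u , v) ⊎ edge e ≡ (v , u))

  irrefl : ∀ {u} e → ¬ (edge e ≡ (u , u))
  irrefl {u} e eq = ℕ.<-irrefl refl (subst (λ (x , y) → x Fin.< y) eq edge-<)
    where
    edge-< : proj₁ (edge e) Fin.< proj₂ (edge e)
    edge-< = proj₁ (proj₂ (∈-filter⁻ (λ (u , v) → (u <? v) ×-dec (u ~G? v))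
                    {xs = cartesianProduct (allFin m) (allFin m)} (∈-lookup e)))

IsSpanningTree : (G : SimpleGraph m) → EdgeSet G → Set
IsSpanningTree G F = IsTree (spanningSubgraph G F)

------------------------------------------------------------------------
-- Decidability of being a spanning tree

lookup-injective : ∀ {A : Set} {xs : List A} → Unique xs →
                   ∀ {i j} → lookup xs i ≡ lookup xs j → i ≡ j
lookup-injective (_  ∷ _) {zero}  {zero}  _  = refl
lookup-injective (x# ∷ _) {zero}  {suc j} eq = ⊥-elim (All.lookup x# (∈-lookup j) eq)
lookup-injective (x# ∷ _) {suc i} {zero}  eq = ⊥-elim (All.lookup x# (∈-lookup i) (sym eq))
lookup-injective (_  ∷ u) {suc i} {suc j} eq = cong suc (lookup-injective u eq)

Unique⇒length≤ : {p : List (Fin m)} → Unique p → length p ≤ m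
Unique⇒length≤ u = injective⇒≤ (lookup-injective u)

boundedList? : ∀ {P : Pred (List (Fin m)) 0ℓ} → Unary.Decidable P →
               ∀ b → Dec (∃[ p ] length p ≤ b × P p)
boundedList? P? zero =
  map′ (λ P[] → [] , z≤n , P[]) (λ { ([] , _ , P[]) → P[] }) (P? [])
boundedList? P? (suc b) =
  map′ (λ { (inj₁ P[])               → [] , z≤n , P[]
          ; (inj₂ (x , p , ≤b , Pxp)) → x ∷ p , s≤s ≤b , Pxp })
       (λ { ([] , _ , P[])            → inj₁ P[]
          ; (x ∷ p , s≤s ≤b , Pxp)    → inj₂ (x , p , ≤b , Pxp) })
       (P? [] ⊎-dec any? λ x → boundedList? (P? ∘ (x ∷_)) b)

uniqueList? : ∀ {P : Pred (List (Fin m)) 0ℓ} → Unary.Decidable P →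
              (∀ {p} → P p → Unique p) → Dec (∃ P)
uniqueList? {m} P? P⇒Unique =
  map′ (λ (p , _ , Pp) → p , Pp) (λ (p , Pp) → p , Unique⇒length≤ (P⇒Unique Pp) , Pp)
       (boundedList? P? m)

module _ (G : SimpleGraph m) where
  open SimpleGraph G

  isPath? : ∀ u v → Unary.Decidable (IsPath G u v)
  isPath? u v p = linked? _~?_ p ×-dec UniqueDec.unique? _≟_ p
    ×-dec ≡-dec _≟_ (head p) (just u) ×-dec ≡-dec _≟_ (last p) (just v)

  isCycle? : Unary.Decidable (IsCycle G)
  isCycle? c = (3 ℕ.≤? length c) ×-dec any? λ u → any? λ v → isPath? u v c ×-dec (v ~? u)

  connected? : Dec (Connected G)
  connected? = all? λ u → all? λ v → uniqueList? (isPath? u v) λ (_ , unique , _) → unique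

  acyclic? : Dec (Acyclic G)
  acyclic? = ¬? (uniqueList? isCycle? λ (_ , _ , _ , (_ , unique , _) , _) → unique)

  isTree? : Dec (IsTree G)
  isTree? = connected? ×-dec acyclic?

isSpanningTree? : (G : SimpleGraph m) → Unary.Decidable (IsSpanningTree G)
isSpanningTree? G F = isTree? (spanningSubgraph G F)

------------------------------------------------------------------------
-- Counting spanning trees

subsets : ∀ n → List (Subset n)
subsets zero    = [] ∷ []
subsets (suc n) = map (inside ∷_) (subsets n) ++ map (outside ∷_) (subsets n)

spanningTrees : (G : SimpleGraph m) → List (EdgeSet G)
spanningTrees G = filter (isSpanningTree? G) (subsets (length (edges G)))

-- The vertices of the k × n grid are numbered row by row: vertex number u is in
-- the row and column (both counted from 0) given by remQuot n u.
gridGraph : ∀ k n → SimpleGraph (k * n)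
gridGraph k n = record
  { _~_      = λ u v → dist u v ≡ 1
  ; _~?_     = λ u v → dist u v ℕ.≟ 1
  ; ~-sym    = λ {u} {v} eq → trans (dist-comm v u) eq
  ; ~-irrefl = λ {u} eq → ℕ.0≢1+n (trans (sym (dist-refl u)) eq)
  }
  where
  row : Fin (k * n) → ℕ
  row u = toℕ (proj₁ (remQuot {k} n u))

  col : Fin (k * n) → ℕ
  col u = toℕ (proj₂ (remQuot {k} n u))

  dist : Fin (k * n) → Fin (k * n) → ℕ
  dist u v = ∣ row u - row v ∣ + ∣ col u - col v ∣

  dist-comm : ∀ u v → dist u v ≡ dist v u
  dist-comm u v = cong₂ _+_ (ℕ.∣-∣-comm (row u) (row v)) (ℕ.∣-∣-comm (col u) (col v))

  dist-refl : ∀ u → dist u u ≡ 0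
  dist-refl u = cong₂ _+_ (ℕ.∣n-n∣≡0 (row u)) (ℕ.∣n-n∣≡0 (col u))

s : ℕ → ℕ → ℕ
s k zero      = 0
s k n@(suc _) = length (spanningTrees (gridGraph k n))

------------------------------------------------------------------------
-- Formal power series over ℤ, as coefficient sequences

PowerSeries : Set
PowerSeries = ℕ → ℤ

open FinSum ℤ.+-0-commutativeMonoid using (sum⁺-syntax)

infixl 7 _⊛_

_⊛_ : PowerSeries → PowerSeries → PowerSeries
(f ⊛ g) n = ∑[ i ≤ n ] (f (toℕ i) ℤ.* g (n ∸ toℕ i))

polynomial : List ℤ → PowerSeries
polynomial []      _       = + 0
polynomial (a ∷ _) zero    = a
polynomial (_ ∷ p) (suc n) = polynomial p n

one : PowerSeries
one = polynomial (+ 1 ∷ [])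

-- f ≈ g / h holds when h is invertible and f is g times the inverse of h.
infix 4 _≈_/_

_≈_/_ : PowerSeries → PowerSeries → PowerSeries → Set
f ≈ g / h = Σ[ h⁻¹ ∈ PowerSeries ] (h ⊛ h⁻¹ ≗ one) × (f ≗ g ⊛ h⁻¹)

-- Coefficients of the two polynomials, constant term first.

N₇ : List ℤ
N₇ =
  + 0 ∷ + 1 ∷ + 142 ∷ - (+ 661245) ∷ + 279917500 ∷ - (+ 53184503243) ∷ + 5570891154842 ∷
  - (+ 341638600598298) ∷ + 11886702497030032 ∷ - (+ 164458937576610742) ∷
  - (+ 4371158470492451828) ∷ + 288737344956855301342 ∷ - (+ 7736513993329973661368) ∷
  + 131582338768322853956994 ∷ - (+ 1573202877300834187134466) ∷ + 13805721749199518460916737 ∷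
  - (+ 90975567796174070740787232) ∷ + 455915282590547643587452175 ∷
  - (+ 1747901867578637315747826286) ∷ + 5126323837327170557921412877 ∷
  - (+ 11416779122947828869806142972) ∷ + 18924703166237080216745900796 ∷
  - (+ 22194247945745188489023284104) ∷ + 15563815847174688069871470516 ∷ + 0 ∷
  - (+ 15563815847174688069871470516) ∷ + 22194247945745188489023284104 ∷
  - (+ 18924703166237080216745900796) ∷ + 11416779122947828869806142972 ∷
  - (+ 5126323837327170557921412877) ∷ + 1747901867578637315747826286 ∷
  - (+ 455915282590547643587452175) ∷ + 90975567796174070740787232 ∷
  - (+ 13805721749199518460916737) ∷ + 1573202877300834187134466 ∷
  - (+ 131582338768322853956994) ∷ + 7736513993329973661368 ∷ - (+ 288737344956855301342) ∷
  + 4371158470492451828 ∷ + 164458937576610742 ∷ - (+ 11886702497030032) ∷ + 341638600598298 ∷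
  - (+ 5570891154842) ∷ + 53184503243 ∷ - (+ 279917500) ∷ + 661245 ∷ - (+ 142) ∷ - (+ 1) ∷ []

D₇ : List ℤ
D₇ =
  + 1 ∷ - (+ 2769) ∷ + 2630641 ∷ - (+ 1195782497) ∷ + 305993127089 ∷ - (+ 48551559344145) ∷
  + 5083730101530753 ∷ - (+ 366971376492201338) ∷ + 18871718211768417242 ∷
  - (+ 709234610141846974874) ∷ + 19874722637854592209338 ∷ - (+ 422023241997789381263002) ∷
  + 6880098547452856483997402 ∷ - (+ 87057778313447181201990522) ∷
  + 862879164715733847737203343 ∷ - (+ 6750900711491569851736413311) ∷
  + 41958615314622858303912597215 ∷ - (+ 208258356862493902206466194607) ∷
  + 828959040281722890327985220255 ∷ - (+ 2654944041424536277948746010303) ∷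
  + 6859440538554030239641036025103 ∷ - (+ 14324708604336971207868317957868) ∷
  + 24214587194571650834572683444012 ∷ - (+ 33166490975387358866518005011884) ∷
  + 36830850383375837481096026357868 ∷ - (+ 33166490975387358866518005011884) ∷
  + 24214587194571650834572683444012 ∷ - (+ 14324708604336971207868317957868) ∷
  + 6859440538554030239641036025103 ∷ - (+ 2654944041424536277948746010303) ∷
  + 828959040281722890327985220255 ∷ - (+ 208258356862493902206466194607) ∷
  + 41958615314622858303912597215 ∷ - (+ 6750900711491569851736413311) ∷
  + 862879164715733847737203343 ∷ - (+ 87057778313447181201990522) ∷
  + 6880098547452856483997402 ∷ - (+ 422023241997789381263002) ∷ + 19874722637854592209338 ∷
  - (+ 709234610141846974874) ∷ + 18871718211768417242 ∷ - (+ 366971376492201338) ∷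
  + 5083730101530753 ∷ - (+ 48551559344145) ∷ + 305993127089 ∷ - (+ 1195782497) ∷ + 2630641 ∷
  - (+ 2769) ∷ + 1 ∷ []

{-# OPTIONS --safe #-}

-- A partition of the vertices is represented by a labelling.  Offering the edges one
-- after the other, and gluing the classes of the ends of each edge that is taken, counts
-- the spanning trees: an edge may be taken iff its ends lie in different classes, and all
-- vertices must end up in one class.  This number does not depend on the order of the
-- edges.  For the grid they are offered column by column, so that only the partition
-- induced on a frontier of seven vertices matters; hence s(7,n+1) is the entry at the
-- discrete partition of a vector vₙ = Mⁿ v₀, where M acts on the vectors indexed by the
-- 429 non-crossing partitions of seven points.  With D₇ = Σᵢ dᵢ tⁱ, the vectors
-- wₘ = Σᵢ dᵢ vₘ₊₄₈₋ᵢ do not vanish, but a monic polynomial of degree 8 in M annihilates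
-- w₀; as the entries of w₀, …, w₇ at the discrete partition are 0, so are those of all wₘ,
-- which is the recurrence with characteristic polynomial D₇.

module Submission where

open import Defs
open import Data.Bool.Base using (Bool; true; false; if_then_else_; not; _∧_)
open import Data.Empty using (⊥)
open import Data.Fin.Base as Fin using (Fin; zero; suc; toℕ; inject₁; combine)
open import Data.Fin.Patterns
open import Data.Fin.Properties as Fin
  using (any?; toℕ-injective; toℕ-inject₁; remQuot-combine; toℕ-combine; combine-monoˡ-<;
         combine-injective; combine-surjective)
open import Data.Fin.Subset using (Subset; inside; outside) renaming (_∈_ to _∈ˢ_)
open import Data.Integer.Base using (ℤ; +_; _+_; _*_; -_; _-_)
import Data.Integer.Properties as ℤ
open import Data.Integer.Tactic.RingSolver using (solve-∀)
open import Data.List.Base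
  using (List; []; _∷_; _++_; map; foldr; filter; length; lookup; head; last; reverse;
         allFin; upTo; tabulate; cartesianProduct)
import Data.List.Membership.DecPropositional as DecMembership
open import Data.List.Membership.Propositional using (_∈_)
open import Data.List.Membership.Propositional.Properties
  using (∈-lookup; ∈-allFin; ∈-upTo⁺; ∈-tabulate⁺; ∈-tabulate⁻; ∈-++⁺ˡ; ∈-++⁺ʳ; ∈-++⁻;
         ∈-filter⁺; ∈-filter⁻; ∈-cartesianProduct⁺)
open import Data.List.Membership.Propositional.Properties.WithK using (unique∧set⇒bag)
open import Data.List.Properties
  using (map-cong; filter-++; filter-≐; length-++; length-reverse; unfold-reverse)
open import Data.List.Relation.Binary.BagAndSetEquality using (∼bag⇒↭)
open import Data.List.Relation.Binary.Permutation.Propositional as Perm using (_↭_; prep; swap)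
open import Data.List.Relation.Unary.All as All using (All; []; _∷_)
import Data.List.Relation.Unary.All.Properties as All
open import Data.List.Relation.Unary.AllPairs using ([]; _∷_)
open import Data.List.Relation.Unary.Any using (here; there)
open import Data.List.Relation.Unary.Linked as Linked using (Linked; []; [-]; _∷_)
open import Data.List.Relation.Unary.Unique.Propositional using (Unique)
import Data.List.Relation.Unary.Unique.Propositional.Properties as Unique
open import Data.Maybe.Base using (just)
open import Data.Maybe.Properties using (just-injective)
open import Data.Nat.Base as ℕ
  using (ℕ; zero; suc; _≤_; _<_; _≡ᵇ_; ∣_-_∣; z≤n; s≤s)
open import Data.Nat.Properties as ℕ using (_≟_)
open import Data.Product using (_×_; _,_; proj₁; proj₂; ∃; ∃₂; ∃-syntax)
import Data.Product.Properties as Product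
open import Data.Sum.Base as Sum using (_⊎_; inj₁; inj₂)
open import Data.Unit.Base using (⊤)
open import Data.Vec.Base as Vec using (Vec; []; _∷_; here; there; _[_]≔_)
open import Data.Vec.Functional using (updateAt)
open import Data.Vec.Functional.Properties using (updateAt-updates; updateAt-minimal)
import Data.Vec.Properties as Vec
open import Function.Base using (_∘_; id; const)
open import Function.Bundles using (mk⇔)
open import Level using (0ℓ)
open import Relation.Binary.Construct.Closure.ReflexiveTransitive as Star
  using (Star; ε; _◅_; _◅◅_; _>>=_)
open import Relation.Binary.Core using (Rel)
open import Relation.Binary.PropositionalEquality
open import Relation.Nullary.Decidable
  using (Dec; yes; no; does; proof; map′; toWitness; ¬?; _×-dec_)
open import Relation.Nullary.Negation using (¬_; contradiction)
open import Relation.Nullary.Reflects using (Reflects; ofʸ; ofⁿ)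
open import Relation.Unary using (Pred; Decidable)

-- The vectors count completions: the entry at a state is the number of ways to finish the remaining
-- columns from it, not the number of partial forests leading to it. A count is thus a functional on
-- labellings, an edge operation acts linearly on such functionals, and a further column is put in
-- front, where it acts as the same operator M. As a partition is only the kernel of a labelling,
-- each functional has to be shown invariant under relabelling (`Invariant`). Independence of the
-- order of the edges rests on one matroid fact, `exchange`. Planarity is never argued: that the
-- non-crossing partitions are closed under the thirteen edge operations of a column is checked by
-- evaluation (`Located`). M is never written down as a matrix either; each edge operation has a
-- table with at most two successors per state, and the thirteen tables are applied in turn.

private
  variable
    V A B : Set
    k m : ℕ

-- Labellings and the number of ways to connect them

infix 4 _⊑_ _≋_

_⊑_ _≋_ : (V → ℕ) → (V → ℕ) → Set
c ⊑ d = ∀ {x y} → c x ≡ c y → d x ≡ d y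
c ≋ d = c ⊑ d × d ⊑ c

≡ᵇ-reflects : ∀ m n → Reflects (m ≡ n) (m ≡ᵇ n)
≡ᵇ-reflects m n = proof (m ≟ n)

-- The asymmetry matters: only the class of `v` changes its label. If `v` is a new vertex, alone in
-- its class, all other labels stay literally the same, which `glued-frontier` uses.
glue : (V → ℕ) → V → V → V → ℕ
glue c u v x = if c x ≡ᵇ c v then c u else c x

module _ (c : V → ℕ) (u v : V) where

  Merged : V → Set
  Merged x = c x ≡ c u ⊎ c x ≡ c v

  glue⁻ : ∀ {x y} → glue c u v x ≡ glue c u v y → c x ≡ c y ⊎ Merged x × Merged y
  glue⁻ {x} {y} eq with c x ≡ᵇ c v | ≡ᵇ-reflects (c x) (c v) | c y ≡ᵇ c v | ≡ᵇ-reflects (c y) (c v)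
  ... | true  | ofʸ p | true  | ofʸ q = inj₁ (trans p (sym q))
  ... | true  | ofʸ p | false | _     = inj₂ (inj₂ p , inj₁ (sym eq))
  ... | false | _     | true  | ofʸ q = inj₂ (inj₁ eq , inj₂ q)
  ... | false | _     | false | _     = inj₁ eq

  ⊑-glue : c ⊑ glue c u v
  ⊑-glue eq rewrite eq = refl

  glue-ends : glue c u v u ≡ glue c u v v
  glue-ends with c u ≡ᵇ c v | c v ≡ᵇ c v | ≡ᵇ-reflects (c v) (c v)
  ... | true  | true  | _      = refl
  ... | false | true  | _      = refl
  ... | _     | false | ofⁿ ¬p = contradiction refl ¬p

  -- Universal property: with `⊑-glue` and `glue-ends` it determines `glue c u v` up to `≋`, so
  -- monotonicity and commutation follow without case analysis.
  glue-least : ∀ {d} → c ⊑ d → d u ≡ d v → glue c u v ⊑ d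
  glue-least {d} c⊑d du≡dv {x} {y} eq with glue⁻ eq
  ... | inj₁ p       = c⊑d p
  ... | inj₂ (p , q) = trans (merged p) (sym (merged q))
    where
    merged : ∀ {z} → Merged z → d z ≡ d u
    merged (inj₁ r) = c⊑d r
    merged (inj₂ r) = trans (c⊑d r) (sym du≡dv)

glue-mono : ∀ {c d : V → ℕ} u v → c ⊑ d → glue c u v ⊑ glue d u v
glue-mono {c = c} {d} u v c⊑d =
  glue-least c u v {glue d u v} (⊑-glue d u v ∘ c⊑d) (glue-ends d u v)

glue-≋ : ∀ {c d : V → ℕ} u v → c ≋ d → glue c u v ≋ glue d u v
glue-≋ u v (p , q) = glue-mono u v p , glue-mono u v q

glue-comm-⊑ : ∀ (c : V → ℕ) u v a b → glue (glue c u v) a b ⊑ glue (glue c a b) u v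
glue-comm-⊑ c u v a b = glue-least _ a b {glue (glue c a b) u v}
  (glue-mono u v (⊑-glue c a b)) (⊑-glue (glue c a b) u v (glue-ends c a b))

glue-comm : ∀ (c : V → ℕ) u v a b → glue (glue c u v) a b ≋ glue (glue c a b) u v
glue-comm c u v a b = glue-comm-⊑ c u v a b , glue-comm-⊑ c a b u v

-- The exchange property of the cycle matroid. Gluing `a` and `b` merges just their two classes; if
-- this joins `u` and `v`, one of them lies in each class, and gluing `u` and `v` merges the same
-- two.
exchange : ∀ (c : V → ℕ) {u v a b} → c u ≢ c v →
           glue c a b u ≡ glue c a b v → glue c u v a ≡ glue c u v b
exchange c {u} {v} {a} {b} u≢v eq with glue⁻ c a b eq
... | inj₁ p                 = contradiction p u≢v
... | inj₂ (inj₁ p , inj₁ q) = contradiction (trans p (sym q)) u≢v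
... | inj₂ (inj₂ p , inj₂ q) = contradiction (trans p (sym q)) u≢v
... | inj₂ (inj₁ p , inj₂ q) =
  trans (⊑-glue c u v (sym p)) (trans (glue-ends c u v) (⊑-glue c u v q))
... | inj₂ (inj₂ p , inj₁ q) =
  trans (⊑-glue c u v (sym q)) (trans (sym (glue-ends c u v)) (⊑-glue c u v p))

count : ((V → ℕ) → ℤ) → List (V × V) → (V → ℕ) → ℤ
count P []             c = P c
count P ((u , v) ∷ es) c =
  count P es c + (if c u ≡ᵇ c v then + 0 else count P es (glue c u v))

-- Gluing only coarsens, so coarsenings of `c` are all that is ever reached. A join already made in
-- `c` may hence be assumed in every final labelling.
count-cong : ∀ {P Q : (V → ℕ) → ℤ} es {c} → (∀ d → c ⊑ d → P d ≡ Q d) → count P es c ≡ count Q es c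
count-cong []             {c} eq = eq c id
count-cong ((u , v) ∷ es) {c} eq with c u ≡ᵇ c v
... | true  = cong (_+ + 0) (count-cong es eq)
... | false = cong₂ _+_ (count-cong es eq)
                (count-cong es λ d glue⊑d → eq d (glue⊑d ∘ ⊑-glue c u v))

Invariant : ((V → ℕ) → ℤ) → Set
Invariant P = ∀ {c d} → c ≋ d → P c ≡ P d

if-cong : ∀ {A B : Set} {a b} → Reflects A a → Reflects B b → {x y : ℤ} →
          (A → B) → (B → A) → (¬ A → x ≡ y) →
          (if a then + 0 else x) ≡ (if b then + 0 else y)
if-cong (ofʸ _)  (ofʸ _)  _ _ _  = refl
if-cong (ofʸ a)  (ofⁿ ¬b) f _ _  = contradiction (f a) ¬b
if-cong (ofⁿ ¬a) (ofʸ b)  _ g _  = contradiction (g b) ¬a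
if-cong (ofⁿ ¬a) (ofⁿ _)  _ _ eq = eq ¬a

count-≋ : ∀ {P : (V → ℕ) → ℤ} → Invariant P → ∀ es → Invariant (count P es)
count-≋ inv []             c≋d = inv c≋d
count-≋ inv ((u , v) ∷ es) {c} {d} c≋d@(p , q) =
  cong₂ _+_ (count-≋ inv es c≋d)
            (if-cong (≡ᵇ-reflects (c u) (c v)) (≡ᵇ-reflects (d u) (d v)) p q λ _ →
              count-≋ inv es (glue-≋ u v c≋d))

module _ {P : (V → ℕ) → ℤ} (inv : Invariant P) where

  private
    swap-arith : ∀ x y z {w w′ : ℤ} → w ≡ w′ → (x + y) + (z + w) ≡ (x + z) + (y + w′)
    swap-arith x y z {w} refl = begin
      (x + y) + (z + w)   ≡⟨ ℤ.+-assoc x y (z + w) ⟩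
      x + (y + (z + w))   ≡⟨ cong (λ t → x + t) (sym (ℤ.+-assoc y z w)) ⟩
      x + ((y + z) + w)   ≡⟨ cong (λ t → x + (t + w)) (ℤ.+-comm y z) ⟩
      x + ((z + y) + w)   ≡⟨ cong (λ t → x + t) (ℤ.+-assoc z y w) ⟩
      x + (z + (y + w))   ≡⟨ sym (ℤ.+-assoc x z (y + w)) ⟩
      (x + z) + (y + w)   ∎
      where open ≡-Reasoning

  -- In the mixed cases a loop stays a loop after gluing the other edge. If neither edge is a loop
  -- at the start, `exchange` shows that taking both is admissible in one order exactly if it is in
  -- the other.
  count-swap : ∀ e f es c → count P (e ∷ f ∷ es) c ≡ count P (f ∷ e ∷ es) c
  count-swap (u , v) (a , b) es c
    with c u ≡ᵇ c v | ≡ᵇ-reflects (c u) (c v) | c a ≡ᵇ c b | ≡ᵇ-reflects (c a) (c b)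
  ... | true | _ | true | _ = refl
  ... | true | ofʸ p | false | _
    with glue c a b u ≡ᵇ glue c a b v | ≡ᵇ-reflects (glue c a b u) (glue c a b v)
  ...   | true  | _      = swap-arith (count P es c) _ (+ 0) refl
  ...   | false | ofⁿ ¬p = contradiction (⊑-glue c a b p) ¬p
  count-swap (u , v) (a , b) es c | false | _ | true | ofʸ p
    with glue c u v a ≡ᵇ glue c u v b | ≡ᵇ-reflects (glue c u v a) (glue c u v b)
  ...   | true  | _      = swap-arith (count P es c) (+ 0) _ refl
  ...   | false | ofⁿ ¬p = contradiction (⊑-glue c u v p) ¬p
  count-swap (u , v) (a , b) es c | false | ofⁿ ¬p | false | ofⁿ ¬q =
    swap-arith (count P es c) _ _
      (if-cong (≡ᵇ-reflects (glue c u v a) (glue c u v b))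
        (≡ᵇ-reflects (glue c a b u) (glue c a b v))
        (exchange c ¬q) (exchange c ¬p) λ _ → count-≋ inv es (glue-comm c u v a b))

  count-prep : ∀ e es fs → (∀ c → count P es c ≡ count P fs c) →
               ∀ c → count P (e ∷ es) c ≡ count P (e ∷ fs) c
  count-prep (u , v) _ _ eq c =
    cong₂ _+_ (eq c) (cong (if c u ≡ᵇ c v then + 0 else_) (eq (glue c u v)))

  count-↭ : ∀ {es fs} → es ↭ fs → ∀ c → count P es c ≡ count P fs c
  count-↭ Perm.refl           c = refl
  count-↭ (prep {es} {fs} e p) c = count-prep e es fs (count-↭ p) c
  count-↭ (swap {es} {fs} e f p) c =
    trans (count-swap e f es c)
          (count-prep f (e ∷ es) (e ∷ fs) (count-prep e es fs (count-↭ p)) c)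
  count-↭ (Perm.trans p q)    c = trans (count-↭ p c) (count-↭ q c)

-- Forests as edge sets that close no loop

merge : (es : List (V × V)) → Subset (length es) → (V → ℕ) → (V → ℕ)
merge []             []            c = c
merge ((u , v) ∷ es) (inside  ∷ F) c = merge es F (glue c u v)
merge (_       ∷ es) (outside ∷ F) c = merge es F c

Forest : (es : List (V × V)) → Subset (length es) → (V → ℕ) → Set
Forest []             []            c = ⊤
Forest ((u , v) ∷ es) (inside  ∷ F) c = c u ≢ c v × Forest es F (glue c u v)
Forest (_       ∷ es) (outside ∷ F) c = Forest es F c

forest? : ∀ (es : List (V × V)) F c → Dec (Forest es F c)
forest? []             []            c = yes _
forest? ((u , v) ∷ es) (inside  ∷ F) c = ¬? (c u ≟ c v) ×-dec forest? es F (glue c u v)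
forest? (_       ∷ es) (outside ∷ F) c = forest? es F c

indicator : ∀ {A : Set} → Dec A → ℤ
indicator A? = if does A? then + 1 else + 0

indicator-cong : ∀ {A B : Set} (A? : Dec A) (B? : Dec B) → (A → B) → (B → A) →
  indicator A? ≡ indicator B?
indicator-cong (yes _) (yes _) _ _ = refl
indicator-cong (yes a) (no ¬b) f _ = contradiction (f a) ¬b
indicator-cong (no ¬a) (yes b) _ g = contradiction (g b) ¬a
indicator-cong (no _)  (no _)  _ _ = refl

length-filter-map : ∀ {A B : Set} (f : A → B) {P : Pred B 0ℓ} {Q : Pred A 0ℓ}
  (P? : Decidable P) (Q? : Decidable Q) → (∀ x → does (P? (f x)) ≡ does (Q? x)) →
  ∀ xs → length (filter P? (map f xs)) ≡ length (filter Q? xs)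
length-filter-map f P? Q? eq [] = refl
length-filter-map f P? Q? eq (x ∷ xs) with does (P? (f x)) | does (Q? x) | eq x
... | true  | true  | _ = cong suc (length-filter-map f P? Q? eq xs)
... | false | false | _ = length-filter-map f P? Q? eq xs
... | true  | false | ()
... | false | true  | ()

filter-none : ∀ {A : Set} {P : Pred A 0ℓ} (P? : Decidable P) xs →
  All (λ x → does (P? x) ≡ false) xs → length (filter P? xs) ≡ 0
filter-none P? []       []       = refl
filter-none P? (x ∷ xs) (p ∷ ps) with does (P? x) | p
... | false | _ = filter-none P? xs ps
... | true  | ()

module _ {Q : Pred (V → ℕ) 0ℓ} (Q? : Decidable Q) where

  forestWith? : ∀ es c → Decidable (λ F → Forest es F c × Q (merge es F c))
  forestWith? es c F = forest? es F c ×-dec Q? (merge es F c)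

  count-forests : ∀ es c →
    + length (filter (forestWith? es c) (subsets (length es))) ≡ count (indicator ∘ Q?) es c
  count-forests [] c with does (Q? c)
  ... | true  = refl
  ... | false = refl
  count-forests ((u , v) ∷ es) c = begin
    + length (filter P? (ins ++ outs))
      ≡⟨ cong (+_ ∘ length) (filter-++ P? ins outs) ⟩
    + length (filter P? ins ++ filter P? outs)
      ≡⟨ cong +_ (length-++ (filter P? ins)) ⟩
    + (length (filter P? ins) ℕ.+ length (filter P? outs))
      ≡⟨ cong +_ (ℕ.+-comm (length (filter P? ins)) _) ⟩
    + length (filter P? outs) + + length (filter P? ins)
      ≡⟨ cong₂ _+_ without-uv with-uv ⟩
    count (indicator ∘ Q?) ((u , v) ∷ es) c
      ∎
    where
    open ≡-Reasoning
    sub  = subsets (length es)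
    ins  = map (inside ∷_) sub
    outs = map (outside ∷_) sub
    P?   = forestWith? ((u , v) ∷ es) c

    -- `does (P? (inside ∷ F))` unfolds to `test F (c u ≡ᵇ c v)`, so the known value of the
    -- comparison enters by `cong`.
    test : Subset (length es) → Bool → Bool
    test F b = (not b ∧ does (forest? es F (glue c u v))) ∧ does (Q? (merge es F (glue c u v)))

    without-uv : + length (filter P? outs) ≡ count (indicator ∘ Q?) es c
    without-uv = trans
      (cong +_ (length-filter-map (outside ∷_) P? (forestWith? es c) (λ _ → refl) sub))
      (count-forests es c)

    with-uv : + length (filter P? ins) ≡
              (if c u ≡ᵇ c v then + 0 else count (indicator ∘ Q?) es (glue c u v))
    with-uv with c u ≡ᵇ c v in eq
    ... | true  = cong +_ (filter-none P? ins loop)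
      where
      loop : All (λ F → does (P? F) ≡ false) ins
      loop = All.map⁺ (All.universal (λ F → cong (test F) eq) sub)
    ... | false = trans
      (cong +_ (length-filter-map (inside ∷_) P? (forestWith? es (glue c u v)) noLoop sub))
      (count-forests es (glue c u v))
      where
      noLoop : ∀ F → does (P? (inside ∷ F)) ≡ does (forestWith? es (glue c u v) F)
      noLoop F = cong (test F) eq

-- Spanning trees as sets of edges that glue without loops

∈-[]≔outside⁻ : ∀ {n} {F : Subset n} {d e} → d ∈ˢ F [ e ]≔ outside → d ∈ˢ F × d ≢ e
∈-[]≔outside⁻ {F = F} {d} {e} d∈ = before F d e d∈ , distinct
  where
  before : ∀ {n} (F : Subset n) d e → d ∈ˢ F [ e ]≔ outside → d ∈ˢ F
  before (_ ∷ F) zero    (suc e) here       = here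
  before (_ ∷ F) (suc d) zero    (there d∈) = there d∈
  before (_ ∷ F) (suc d) (suc e) (there d∈) = there (before F d e d∈)

  distinct : d ≢ e
  distinct refl with () ← Vec.[]=-injective d∈ (Vec.[]≔-updates F e)

Agree : List V → (V → ℕ) → Set
Agree S c = ∀ {x y} → x ∈ S → y ∈ S → c x ≡ c y

agree? : ∀ (S : List V) c → Dec (Agree S c)
agree? S c = map′ (λ all x∈ y∈ → All.lookup (All.lookup all x∈) y∈)
                  (λ eq → All.tabulate λ x∈ → All.tabulate λ y∈ → eq x∈ y∈)
                  (All.all? (λ x → All.all? (λ y → c x ≟ c y) S) S)

⊑-merge : ∀ (es : List (V × V)) F c → c ⊑ merge es F c
⊑-merge []             []            c = id
⊑-merge ((u , v) ∷ es) (inside  ∷ F) c = ⊑-merge es F _ ∘ ⊑-glue c u v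
⊑-merge (_       ∷ es) (outside ∷ F) c = ⊑-merge es F c

Joins : V × V → V → V → Set
Joins e x y = e ≡ (x , y) ⊎ e ≡ (y , x)

Adj : (es : List (V × V)) → Subset (length es) → V → V → Set
Adj es F x y = ∃[ e ] e ∈ˢ F × Joins (lookup es e) x y

merge-edge : ∀ (es : List (V × V)) {F e u v} c → e ∈ˢ F → lookup es e ≡ (u , v) →
             merge es F c u ≡ merge es F c v
merge-edge (_ ∷ es) {F = inside  ∷ F} c here       refl = ⊑-merge es F _ (glue-ends c _ _)
merge-edge (_ ∷ es) {F = inside  ∷ F} c (there e∈) eq   = merge-edge es _ e∈ eq
merge-edge (_ ∷ es) {F = outside ∷ F} c (there e∈) eq   = merge-edge es c e∈ eq

star⇒merge : ∀ (es : List (V × V)) {F} c {x y} → Star (Adj es F) x y →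
             merge es F c x ≡ merge es F c y
star⇒merge es c ε                        = refl
star⇒merge es c ((e , e∈ , inj₁ eq) ◅ r) = trans (merge-edge es c e∈ eq) (star⇒merge es c r)
star⇒merge es c ((e , e∈ , inj₂ eq) ◅ r) = trans (sym (merge-edge es c e∈ eq)) (star⇒merge es c r)

merge⇒star : ∀ (es : List (V × V)) F c {x y} → merge es F c x ≡ merge es F c y →
             Star (λ a b → c a ≡ c b ⊎ Adj es F a b) x y
merge⇒star []             []            c eq = inj₁ eq ◅ ε
merge⇒star (e ∷ es)       (outside ∷ F) c eq =
  Star.map (Sum.map₂ λ (e , e∈ , j) → suc e , there e∈ , j) (merge⇒star es F c eq)
merge⇒star ((u , v) ∷ es) (inside  ∷ F) c eq = merge⇒star es F (glue c u v) eq >>= expand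
  where
  Step = λ a b → c a ≡ c b ⊎ Adj ((u , v) ∷ es) (inside ∷ F) a b

  toU : ∀ {a} → Merged c u v a → Star Step a u
  toU (inj₁ p) = inj₁ p ◅ ε
  toU (inj₂ p) = inj₁ p ◅ inj₂ (zero , here , inj₂ refl) ◅ ε

  fromU : ∀ {a} → Merged c u v a → Star Step u a
  fromU (inj₁ p) = inj₁ (sym p) ◅ ε
  fromU (inj₂ p) = inj₂ (zero , here , inj₁ refl) ◅ inj₁ (sym p) ◅ ε

  expand : ∀ {a b} → glue c u v a ≡ glue c u v b ⊎ Adj es F a b → Star Step a b
  expand (inj₂ (e , e∈ , j)) = inj₂ (suc e , there e∈ , j) ◅ ε
  expand (inj₁ eq) with glue⁻ c u v eq
  ... | inj₁ p       = inj₁ p ◅ ε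
  ... | inj₂ (p , q) = toU p ◅◅ fromU q

forest-≋ : ∀ (es : List (V × V)) F {c d} → c ≋ d → Forest es F c → Forest es F d
forest-≋ []             []            _           _         = _
forest-≋ ((u , v) ∷ es) (inside  ∷ F) c≋d@(_ , q) (u≢v , f) =
  u≢v ∘ q , forest-≋ es F (glue-≋ u v c≋d) f
forest-≋ (_       ∷ es) (outside ∷ F) c≋d         f         = forest-≋ es F c≋d f

-- The first edge may be moved to the end: by commutation of gluing and `exchange`, edges that close
-- no loop on top of the join of `u` and `v` cannot produce this join themselves.
forest-glue : ∀ (es : List (V × V)) F {c u v} → Forest es F (glue c u v) → c u ≢ c v →
              merge es F c u ≢ merge es F c v
forest-glue []             []            _         u≢v = u≢v
forest-glue ((a , b) ∷ es) (inside  ∷ F) {c} {u} {v} (a≢b , f) u≢v =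
  forest-glue es F (forest-≋ es F (glue-comm c u v a b) f) (a≢b ∘ exchange c u≢v)
forest-glue (_       ∷ es) (outside ∷ F) f         u≢v = forest-glue es F f u≢v

-- `Forest` tests an edge against the earlier ones only; this tests it against all others, as
-- acyclicity does.
Bridges : (es : List (V × V)) → Subset (length es) → (V → ℕ) → Set
Bridges es F c = ∀ e → e ∈ˢ F → let (u , v) = lookup es e ; F′ = F [ e ]≔ outside in
                 merge es F′ c u ≢ merge es F′ c v

forest⇒bridges : ∀ (es : List (V × V)) F {c} → Forest es F c → Bridges es F c
forest⇒bridges (_ ∷ es) (inside  ∷ F) (u≢v , f) zero    here       = forest-glue es F f u≢v
forest⇒bridges (_ ∷ es) (inside  ∷ F) (_   , f) (suc e) (there e∈) = forest⇒bridges es F f e e∈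
forest⇒bridges (_ ∷ es) (outside ∷ F) f         (suc e) (there e∈) = forest⇒bridges es F f e e∈

bridges⇒forest : ∀ (es : List (V × V)) F {c} → Bridges es F c → Forest es F c
bridges⇒forest []       []            _ = _
bridges⇒forest (_ ∷ es) (inside  ∷ F) {c} br =
  br zero here ∘ ⊑-merge es F c , bridges⇒forest es F λ e → br (suc e) ∘ there
bridges⇒forest (_ ∷ es) (outside ∷ F) br = bridges⇒forest es F λ e → br (suc e) ∘ there

-- Walks, simple paths and cycles

Path : Rel (Fin m) 0ℓ → Fin m → Fin m → List (Fin m) → Set
Path R u v p = Linked R p × Unique p × head p ≡ just u × last p ≡ just v

module _ {R : Rel (Fin m) 0ℓ} where

  path-suffix : ∀ {u y v} p → Path R y v p → u ∈ p → ∃[ q ] Path R u v q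
  path-suffix p@(x ∷ _) (l , un , _ , la) (here refl) = p , l , un , refl , la
  path-suffix (x ∷ y ∷ p) (_ ∷ l , _ ∷ un , _ , la) (there u∈) =
    path-suffix (y ∷ p) (l , un , refl , la) u∈

  -- Loop erasure: if the new start already occurs on the path, the path is cut back to the suffix
  -- that begins there.
  star⇒path : ∀ {u v} → Star R u v → ∃[ p ] Path R u v p
  star⇒path {u} ε = u ∷ [] , [-] , [] ∷ [] , refl , refl
  star⇒path {u} (r ◅ rs) with star⇒path rs
  ... | y ∷ p , path@(l , un , refl , la) with u ∈? (y ∷ p)
    where open DecMembership Fin._≟_
  ...   | yes u∈ = path-suffix (y ∷ p) path u∈
  ...   | no  u∉ = u ∷ y ∷ p , r ∷ l , All.¬Any⇒All¬ _ u∉ ∷ un , refl , la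

  linked⇒star : ∀ {u v} p → Linked R p → head p ≡ just u → last p ≡ just v → Star R u v
  linked⇒star (_ ∷ [])    _       refl refl = ε
  linked⇒star (_ ∷ y ∷ p) (r ∷ l) refl la   = r ◅ linked⇒star (y ∷ p) l refl la

last-∈ : ∀ {A : Set} {x : A} xs → last xs ≡ just x → x ∈ xs
last-∈ (_ ∷ [])     refl = here refl
last-∈ (_ ∷ y ∷ xs) eq   = there (last-∈ (y ∷ xs) eq)

module _ (G : SimpleGraph m) where
  open SimpleGraph G

  edge-ordered : ∀ e → proj₁ (lookup (edges G) e) Fin.< proj₂ (lookup (edges G) e)
  edge-ordered e = proj₁ (proj₂ (∈-filter⁻ (λ (u , v) → (u Fin.<? v) ×-dec (u ~? v))
    {xs = cartesianProduct (allFin m) (allFin m)} (∈-lookup e)))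

  edges-unique : Unique (edges G)
  edges-unique = Unique.filter⁺ _ (Unique.cartesianProduct⁺ (Unique.allFin⁺ m) (Unique.allFin⁺ m))

  joins-same : ∀ {d e x y} → Joins (lookup (edges G) d) x y → Joins (lookup (edges G) e) x y → d ≡ e
  joins-same {d} {e} p q =
    lookup-injective edges-unique (same (edge-ordered d) (edge-ordered e) p q)
    where
    same : ∀ {d e : Fin m × Fin m} {x y} → proj₁ d Fin.< proj₂ d → proj₁ e Fin.< proj₂ e →
           Joins d x y → Joins e x y → d ≡ e
    same _ _ (inj₁ refl) (inj₁ refl) = refl
    same p q (inj₁ refl) (inj₂ refl) = contradiction q (Fin.<-asym p)
    same p q (inj₂ refl) (inj₁ refl) = contradiction q (Fin.<-asym p)
    same _ _ (inj₂ refl) (inj₂ refl) = refl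

  module _ (F : EdgeSet G) where

    private
      es = edges G
      S  = spanningSubgraph G F

    merge⇒reachable : ∀ {F x y} → merge es F toℕ x ≡ merge es F toℕ y → Star (Adj es F) x y
    merge⇒reachable {F} eq = merge⇒star es F toℕ eq >>= λ
      { (inj₁ p) → subst (Star (Adj es F) _) (toℕ-injective p) ε
      ; (inj₂ a) → a ◅ ε }

    connected⇒agree : Connected S → Agree (allFin m) (merge es F toℕ)
    connected⇒agree conn {x} {y} _ _ with p , l , _ , h , la ← conn x y =
      star⇒merge es toℕ (linked⇒star p l h la)

    agree⇒connected : Agree (allFin m) (merge es F toℕ) → Connected S
    agree⇒connected agree x y = star⇒path (merge⇒reachable (agree (∈-allFin x) (∈-allFin y)))

    -- A path between the ends of `e` that avoids `e` closes up with `e` to a cycle. It has at least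
    -- three vertices: one vertex would make the ends equal, and two would make its only edge `e`
    -- itself by `joins-same`.
    acyclic⇒bridges : Acyclic S → Bridges es F toℕ
    acyclic⇒bridges acyclic e e∈F eq with star⇒path (merge⇒reachable {F [ e ]≔ outside} eq)
    ... | _ ∷ []    , _ , _ , refl , la = Fin.<-irrefl (just-injective la) (edge-ordered e)
    ... | _ ∷ _ ∷ [] , (d , d∈ , j) ∷ _ , _ , refl , refl =
      proj₂ (∈-[]≔outside⁻ d∈) (joins-same j (inj₁ refl))
    ... | p@(_ ∷ _ ∷ _ ∷ _) , l , un , h , la =
      acyclic (p , s≤s (s≤s (s≤s z≤n)) , _ , _ ,
        (Linked.map (λ (d , d∈ , j) → d , proj₁ (∈-[]≔outside⁻ d∈) , j) l , un , h , la) ,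
        (e , e∈F , inj₂ refl))

    -- The first edge `e` of a cycle is no bridge, as the rest of the cycle joins its ends: the
    -- later edges of the path avoid `u`, and the closing edge differs from `e` because the vertices
    -- are distinct.
    bridges⇒acyclic : Bridges es F toℕ → Acyclic S
    bridges⇒acyclic _ (_ ∷ [] , s≤s () , _)
    bridges⇒acyclic _ (_ ∷ _ ∷ [] , s≤s (s≤s ()) , _)
    bridges⇒acyclic bridges
      (u ∷ x ∷ y ∷ p , _ , _ , v , ((e , e∈F , j) ∷ l , u# ∷ x# ∷ _ , refl , la) , (d , d∈F , k)) =
      absurd j (star⇒merge es toℕ (linked⇒star (x ∷ y ∷ p) (avoid (x ∷ y ∷ p) u# l) refl la ◅◅
                                   (d , Vec.[]≔-minimal _ _ _ d≢e d∈F , k) ◅ ε))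
      where
      v∈ : v ∈ y ∷ p
      v∈ = last-∈ (y ∷ p) la

      other : ∀ {e : Fin m × Fin m} {a b c d} → Joins e a b → Joins e c d → b ≡ c ⊎ b ≡ d
      other (inj₁ refl) (inj₁ refl) = inj₂ refl
      other (inj₁ refl) (inj₂ refl) = inj₁ refl
      other (inj₂ refl) (inj₁ refl) = inj₁ refl
      other (inj₂ refl) (inj₂ refl) = inj₂ refl

      d≢e : d ≢ e
      d≢e refl with other j k
      ... | inj₁ refl = All.lookup x# v∈ refl
      ... | inj₂ refl = All.lookup u# (here refl) refl

      avoid : ∀ q → All (u ≢_) q → Linked (Adj es F) q → Linked (Adj es (F [ e ]≔ outside)) q
      avoid []          _              _                   = []
      avoid (_ ∷ [])    _              _                   = [-]
      avoid (a ∷ b ∷ q) (u≢a ∷ u≢s@(u≢b ∷ _)) ((f , f∈F , i) ∷ l) =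
        (f , Vec.[]≔-minimal _ _ _ f≢e f∈F , i) ∷ avoid (b ∷ q) u≢s l
        where
        f≢e : f ≢ e
        f≢e refl with other (Sum.swap j) i
        ... | inj₁ refl = u≢a refl
        ... | inj₂ refl = u≢b refl

      absurd : Joins (lookup es e) u x →
        merge es (F [ e ]≔ outside) toℕ x ≢ merge es (F [ e ]≔ outside) toℕ u
      absurd (inj₁ p) eq =
        bridges e e∈F (subst (λ (a , b) → merge es _ toℕ a ≡ merge es _ toℕ b) (sym p) (sym eq))
      absurd (inj₂ p) eq =
        bridges e e∈F (subst (λ (a , b) → merge es _ toℕ a ≡ merge es _ toℕ b) (sym p) eq)

  length-spanningTrees :
    + length (spanningTrees G) ≡ count (indicator ∘ agree? (allFin m)) (edges G) toℕ
  length-spanningTrees = trans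
    (cong (+_ ∘ length)
      (filter-≐ (isSpanningTree? G) (forestWith? (agree? (allFin m)) (edges G) toℕ)
      ((λ {F} (conn , acyc) →
        bridges⇒forest (edges G) F (acyclic⇒bridges F acyc) , connected⇒agree F conn) ,
       (λ {F} (forest , agree) →
         agree⇒connected F agree , bridges⇒acyclic F (forest⇒bridges (edges G) F forest)))
      (subsets (length (edges G)))))
    (count-forests (agree? (allFin m)) (edges G) toℕ)

-- Sweeping a frontier through a graph

infixl 10 _[_≔_]

_[_≔_] : (Fin k → V) → Fin k → V → Fin k → V
φ [ i ≔ x ] = updateAt φ i (const x)

update-elim : ∀ (P : Fin k → V → Set) {φ i x} → P i x → (∀ j → j ≢ i → P j (φ j)) →
              ∀ j → P j ((φ [ i ≔ x ]) j)
update-elim P {φ} {i} {x} at-i off j with j Fin.≟ i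
... | yes refl = subst (P j) (sym (updateAt-updates i φ)) at-i
... | no  j≢i  = subst (P j) (sym (updateAt-minimal j i φ j≢i)) (off j j≢i)

update-≋ : ∀ {κ λ′ : Fin k → ℕ} i {x y} → κ ≋ λ′ → (∀ j → x ≢ κ j) → (∀ j → y ≢ λ′ j) →
           κ [ i ≔ x ] ≋ λ′ [ i ≔ y ]
update-≋ {κ = κ} {λ′} i (p , q) x# y# = half p x# , half q y#
  where
  half : ∀ {κ λ′ : Fin _ → ℕ} {x y} → κ ⊑ λ′ → (∀ j → x ≢ κ j) → κ [ i ≔ x ] ⊑ λ′ [ i ≔ y ]
  half {κ} {λ′} {x} {y} p x# {a} {b} eq with a Fin.≟ i | b Fin.≟ i
  ... | yes refl | yes refl = refl
  ... | yes refl | no b≢i   = contradiction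
    (trans (sym (updateAt-updates i κ)) (trans eq (updateAt-minimal b i κ b≢i))) (x# b)
  ... | no a≢i   | yes refl = contradiction
    (trans (sym (updateAt-updates i κ)) (trans (sym eq) (updateAt-minimal a i κ a≢i))) (x# a)
  ... | no a≢i   | no b≢i   = begin
    (λ′ [ i ≔ y ]) a  ≡⟨ updateAt-minimal a i λ′ a≢i ⟩
    λ′ a              ≡⟨ p κa≡κb ⟩
    λ′ b              ≡⟨ updateAt-minimal b i λ′ b≢i ⟨
    (λ′ [ i ≔ y ]) b  ∎
    where
    open ≡-Reasoning

    κa≡κb : κ a ≡ κ b
    κa≡κb = trans (sym (updateAt-minimal a i κ a≢i)) (trans eq (updateAt-minimal b i κ b≢i))

≗⇒≋ : {c d : V → ℕ} → c ≗ d → c ≋ d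
≗⇒≋ eq = (λ {x} {y} p → trans (sym (eq x)) (trans p (eq y))) ,
         (λ {x} {y} p → trans (eq x) (trans p (sym (eq y))))

glue-off : ∀ (c : V → ℕ) u {v x} → c x ≢ c v → glue c u v x ≡ c x
glue-off c u {v} {x} x≢v with c x ≡ᵇ c v | ≡ᵇ-reflects (c x) (c v)
... | true  | ofʸ p = contradiction p x≢v
... | false | _     = refl

glue-at : ∀ (c : V → ℕ) u v → glue c u v v ≡ c u
glue-at c u v with c v ≡ᵇ c v | ≡ᵇ-reflects (c v) (c v)
... | true  | _      = refl
... | false | ofⁿ ¬p = contradiction refl ¬p

agree-⊑ : ∀ {S : List V} {c d} → c ⊑ d → Agree S c → Agree S d
agree-⊑ c⊑d agree x∈ y∈ = c⊑d (agree x∈ y∈)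

agree-invariant : ∀ (S : List V) → Invariant (indicator ∘ agree? S)
agree-invariant S {c} {d} (p , q) =
  indicator-cong (agree? S c) (agree? S d)
    (λ a {x} {y} → agree-⊑ {c = c} {d} p a {x} {y})
    (λ a {x} {y} → agree-⊑ {c = d} {c} q a {x} {y})

-- The edges are offered one at a time to a frontier of k vertices, one per row:
-- join i j offers the edge between the rows i and j, and shift i offers the edge from
-- row i to a new vertex, which then replaces its neighbour in the frontier.
data Op (k : ℕ) : Set where
  join  : Fin k → Fin k → Op k
  shift : Fin k → Op k

Shared : (Fin k → ℕ) → Fin k → Set
Shared κ i = ∃[ j ] j ≢ i × κ j ≡ κ i

shared? : ∀ (κ : Fin k → ℕ) i → Dec (Shared κ i)
shared? κ i = any? λ j → ¬? (j Fin.≟ i) ×-dec (κ j ≟ κ i)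

total : (Fin k → ℕ) → ℕ
total {zero}  κ = 0
total {suc k} κ = κ zero ℕ.+ total (κ ∘ suc)

≤-total : ∀ (κ : Fin k → ℕ) i → κ i ℕ.≤ total κ
≤-total κ zero    = ℕ.m≤m+n _ _
≤-total κ (suc i) = ℕ.≤-trans (≤-total (κ ∘ suc) i) (ℕ.m≤n+m _ _)

fresh : (Fin k → ℕ) → ℕ
fresh κ = suc (total κ)

fresh-≢ : ∀ (κ : Fin k → ℕ) i → fresh κ ≢ κ i
fresh-≢ κ i = ℕ.>⇒≢ (ℕ.s≤s (≤-total κ i))

-- A shift without the new edge abandons the old vertex of row i, which is
-- admissible only if its component still meets the frontier.
successors : Op k → (Fin k → ℕ) → List (Fin k → ℕ)
successors (join i j) κ = κ ∷ (if κ i ≡ᵇ κ j then [] else glue κ i j ∷ [])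
successors (shift i)  κ = κ ∷ (if does (shared? κ i) then κ [ i ≔ fresh κ ] ∷ [] else [])

sumOver : ∀ {A : Set} → (A → ℤ) → List A → ℤ
sumOver f = foldr _+_ (+ 0) ∘ map f

run : List (Op k) → ((Fin k → ℕ) → ℤ) → (Fin k → ℕ) → ℤ
run []      f κ = f κ
run (o ∷ p) f κ = sumOver (run p f) (successors o κ)

value : List (Op k) → (Fin k → ℕ) → ℤ
value p = run p (indicator ∘ agree? (allFin _))

run-join : ∀ i j p f (κ : Fin k → ℕ) →
  run (join i j ∷ p) f κ ≡ run p f κ + (if κ i ≡ᵇ κ j then + 0 else run p f (glue κ i j))
run-join i j p f κ with κ i ≡ᵇ κ j
... | true  = refl
... | false = cong (_+_ (run p f κ)) (ℤ.+-identityʳ _)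

run-≋ : ∀ (p : List (Op k)) {f} → Invariant f → Invariant (run p f)
run-≋ []             inv c≋d = inv c≋d
run-≋ (join i j ∷ p) {f} inv {c} {d} c≋d@(q , r) = begin
  run (join i j ∷ p) f c
    ≡⟨ run-join i j p f c ⟩
  run p f c + (if c i ≡ᵇ c j then + 0 else run p f (glue c i j))
    ≡⟨ cong₂ _+_ (run-≋ p inv c≋d) (if-cong (≡ᵇ-reflects (c i) (c j)) (≡ᵇ-reflects (d i) (d j)) q r
         λ _ → run-≋ p inv (glue-≋ i j c≋d)) ⟩
  run p f d + (if d i ≡ᵇ d j then + 0 else run p f (glue d i j))
    ≡⟨ run-join i j p f d ⟨
  run (join i j ∷ p) f d
    ∎
  where open ≡-Reasoning
run-≋ (shift i ∷ p) inv {c} {d} c≋d@(q , r) with shared? c i | shared? d i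
... | yes _           | yes _           =
  cong₂ _+_ (run-≋ p inv c≋d)
    (cong (_+ + 0) (run-≋ p inv (update-≋ i c≋d (fresh-≢ c) (fresh-≢ d))))
... | yes (j , ≢ , e) | no ¬s           = contradiction (j , ≢ , q e) ¬s
... | no ¬s           | yes (j , ≢ , e) = contradiction (j , ≢ , r e) ¬s
... | no _            | no _            = cong (_+ + 0) (run-≋ p inv c≋d)

value-≋ : ∀ (p : List (Op k)) → Invariant (value p)
value-≋ p = run-≋ p (agree-invariant (allFin _))

-- The clause for a shift without a waiting vertex is a default; `count-sweep` excludes it by
-- `shifts p ≡ length ws`.
sweep : List (Op k) → (Fin k → V) → List V → List (V × V)
sweep []             φ ws       = []
sweep (join i j ∷ p) φ ws       = (φ i , φ j) ∷ sweep p φ ws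
sweep (shift i ∷ p)  φ []       = []
sweep (shift i ∷ p)  φ (w ∷ ws) = (φ i , w) ∷ sweep p (φ [ i ≔ w ]) ws

-- The vertices whose agreement is still to be demanded. A vertex may leave this list when another
-- one on it carries the same label (`agree-shift`).
active : (Fin k → V) → List V → List V
active φ ws = tabulate φ ++ ws

frontier-∈ : ∀ (φ : Fin k → V) {ws} i → φ i ∈ active φ ws
frontier-∈ φ i = ∈-++⁺ˡ (∈-tabulate⁺ i)

waiting-∈ : ∀ (φ : Fin k → V) {ws x} → x ∈ ws → x ∈ active φ ws
waiting-∈ φ = ∈-++⁺ʳ (tabulate φ)

active-elim : ∀ {P : V → Set} (φ : Fin k → V) {ws} → (∀ i → P (φ i)) → (∀ {x} → x ∈ ws → P x) →
              ∀ {x} → x ∈ active φ ws → P x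
active-elim φ f g x∈ with ∈-++⁻ (tabulate φ) x∈
... | inj₂ x∈ws = g x∈ws
... | inj₁ x∈φ with i , refl ← ∈-tabulate⁻ x∈φ = f i

module _ (φ : Fin k → V) (i : Fin k) (w : V) (ws : List V) where

  shift-⊆ : ∀ {x} → x ∈ active (φ [ i ≔ w ]) ws → x ∈ active φ (w ∷ ws)
  shift-⊆ = active-elim (φ [ i ≔ w ])
    (update-elim (λ _ x → x ∈ active φ (w ∷ ws)) (waiting-∈ φ (here refl)) λ j _ → frontier-∈ φ j)
    (waiting-∈ φ ∘ there)

  w∈shifted : w ∈ active (φ [ i ≔ w ]) ws
  w∈shifted = subst (_∈ active (φ [ i ≔ w ]) ws) (updateAt-updates i φ) (frontier-∈ (φ [ i ≔ w ]) i)

  kept∈shifted : ∀ j → j ≢ i → φ j ∈ active (φ [ i ≔ w ]) ws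
  kept∈shifted j j≢i =
    subst (_∈ active (φ [ i ≔ w ]) ws) (updateAt-minimal j i φ j≢i) (frontier-∈ (φ [ i ≔ w ]) j)

  shift-⊇ : ∀ {x} → x ∈ active φ (w ∷ ws) → x ≡ φ i ⊎ x ∈ active (φ [ i ≔ w ]) ws
  shift-⊇ = active-elim φ front λ
    { (here refl) → inj₂ w∈shifted
    ; (there x∈)  → inj₂ (waiting-∈ (φ [ i ≔ w ]) x∈) }
    where
    front : ∀ j → φ j ≡ φ i ⊎ φ j ∈ active (φ [ i ≔ w ]) ws
    front j with j Fin.≟ i
    ... | yes refl = inj₁ refl
    ... | no  j≢i  = inj₂ (kept∈shifted j j≢i)

  agree-shift : ∀ c {y} → y ∈ active (φ [ i ≔ w ]) ws → c (φ i) ≡ c y →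
    indicator (agree? (active φ (w ∷ ws)) c) ≡ indicator (agree? (active (φ [ i ≔ w ]) ws) c)
  agree-shift c {y} y∈ eq = indicator-cong (agree? _ c) (agree? _ c)
    (λ agree x∈ z∈ → agree (shift-⊆ x∈) (shift-⊆ z∈))
    (λ agree {x} {z} x∈ z∈ →
       trans (to-y agree (shift-⊇ x∈)) (sym (to-y agree (shift-⊇ z∈))))
    where
    to-y : Agree (active (φ [ i ≔ w ]) ws) c → ∀ {x} → x ≡ φ i ⊎ x ∈ active (φ [ i ≔ w ]) ws →
      c x ≡ c y
    to-y agree (inj₁ refl) = eq
    to-y agree (inj₂ x∈)   = agree x∈ y∈

sweep-active : ∀ p (φ : Fin k → V) ws →
  All (λ (u , v) → u ∈ active φ ws × v ∈ active φ ws) (sweep p φ ws)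
sweep-active []             φ ws       = []
sweep-active (join i j ∷ p) φ ws       = (frontier-∈ φ i , frontier-∈ φ j) ∷ sweep-active p φ ws
sweep-active (shift i ∷ p)  φ []       = []
sweep-active (shift i ∷ p)  φ (w ∷ ws) = (frontier-∈ φ i , waiting-∈ φ (here refl)) ∷
  All.map (λ (u∈ , v∈) → shift-⊆ φ i w ws u∈ , shift-⊆ φ i w ws v∈)
    (sweep-active p (φ [ i ≔ w ]) ws)

-- For the shift that would abandon a whole component: the remaining edges have both ends in `S`, so
-- no gluing ever reaches the class of `w`.
count-isolated : ∀ {P : (V → ℕ) → ℤ} {S : List V} {w} es {c} →
  All (λ (u , v) → u ∈ S × v ∈ S) es → (∀ d → (∀ {x} → x ∈ S → d x ≢ d w) → P d ≡ + 0) →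
  (∀ {x} → x ∈ S → c x ≢ c w) → count P es c ≡ + 0
count-isolated []             []               P≡0 isolated = P≡0 _ isolated
count-isolated ((u , v) ∷ es) {c} ((u∈ , v∈) ∷ es⊆) P≡0 isolated with c u ≡ᵇ c v
... | true  = cong (_+ + 0) (count-isolated es es⊆ P≡0 isolated)
... | false = cong₂ _+_ (count-isolated es es⊆ P≡0 isolated) (count-isolated es es⊆ P≡0 isolated′)
  where
  isolated′ : ∀ {x} → x ∈ _ → glue c u v x ≢ glue c u v _
  isolated′ x∈ eq with glue⁻ c u v eq
  ... | inj₁ p            = isolated x∈ p
  ... | inj₂ (_ , inj₁ p) = isolated u∈ (sym p)
  ... | inj₂ (_ , inj₂ p) = isolated v∈ (sym p)

record Untouched (c : V → ℕ) (φ : Fin k → V) (ws : List V) : Set where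
  field
    unique    : Unique ws
    injective : ∀ {x y} → x ∈ ws → y ∈ ws → c x ≡ c y → x ≡ y
    separate  : ∀ {x} i → x ∈ ws → c x ≢ c (φ i)

open Untouched

shifts : List (Op k) → ℕ
shifts []            = 0
shifts (join _ _ ∷ p) = shifts p
shifts (shift _ ∷ p)  = suc (shifts p)

untouched-glue : ∀ {c : V → ℕ} {φ : Fin k → V} {ws} i j → Untouched c φ ws →
                 Untouched (glue c (φ i) (φ j)) φ ws
untouched-glue {c = c} {φ} i j U = record
  { unique    = unique U
  ; injective = λ x∈ y∈ eq → injective U x∈ y∈
      (trans (sym (glue-off c (φ i) (separate U j x∈)))
        (trans eq (glue-off c (φ i) (separate U j y∈))))
  ; separate  = λ l x∈ eq → apart l x∈ (glue⁻ c (φ i) (φ j) eq)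
  }
  where
  apart : ∀ {x} l → x ∈ _ → c x ≡ c (φ l) ⊎ Merged c (φ i) (φ j) x × Merged c (φ i) (φ j) (φ l) → ⊥
  apart l x∈ (inj₁ p)            = separate U l x∈ p
  apart l x∈ (inj₂ (inj₁ p , _)) = separate U i x∈ p
  apart l x∈ (inj₂ (inj₂ p , _)) = separate U j x∈ p

module _ {c : V → ℕ} {φ : Fin k → V} {w ws} (i : Fin k) (U : Untouched c φ (w ∷ ws)) where

  private
    w≢ : ∀ {x} → x ∈ ws → c x ≢ c w
    w≢ x∈ eq with refl ← injective U (there x∈) (here refl) eq
      with w# ∷ _ ← unique U = All.lookup w# x∈ refl

    tail-unique : Unique ws
    tail-unique with _ ∷ un ← unique U = un

  untouched-drop : Untouched c (φ [ i ≔ w ]) ws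
  untouched-drop = record
    { unique    = tail-unique
    ; injective = λ x∈ y∈ → injective U (there x∈) (there y∈)
    ; separate  =
      λ j x∈ → update-elim (λ _ y → c _ ≢ c y) (w≢ x∈) (λ l _ → separate U l (there x∈)) j
    }

  glued : V → ℕ
  glued = glue c (φ i) w

  glued-frontier : glued ∘ φ [ i ≔ w ] ≗ c ∘ φ
  glued-frontier = update-elim (λ j x → glued x ≡ c (φ j)) (glue-at c (φ i) w)
    λ j _ → glue-off c (φ i) (separate U j (here refl) ∘ sym)

  untouched-glued : Untouched glued (φ [ i ≔ w ]) ws
  untouched-glued = record
    { unique    = tail-unique
    ; injective = λ x∈ y∈ eq → injective U (there x∈) (there y∈)
        (trans (sym (glue-off c (φ i) (w≢ x∈))) (trans eq (glue-off c (φ i) (w≢ y∈))))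
    ; separate  = λ j x∈ eq → separate U j (there x∈)
        (trans (sym (glue-off c (φ i) (w≢ x∈))) (trans eq (glued-frontier j)))
    }

  -- The label of `w` depends on the whole graph, `fresh` on the frontier alone; both are new to the
  -- frontier, hence interchangeable up to `≋`.
  dropped-frontier : c ∘ φ [ i ≔ w ] ≋ (c ∘ φ) [ i ≔ fresh (c ∘ φ) ]
  dropped-frontier =
    subst-≗ (update-≋ i (id , id) (λ j → separate U j (here refl)) (fresh-≢ (c ∘ φ)))
    where
    pointwise : c ∘ φ [ i ≔ w ] ≗ (c ∘ φ) [ i ≔ c w ]
    pointwise j = update-elim (λ j x → c x ≡ ((c ∘ φ) [ i ≔ c w ]) j)
      (sym (updateAt-updates i (c ∘ φ))) (λ j j≢i → sym (updateAt-minimal j i (c ∘ φ) j≢i)) j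

    subst-≗ : ∀ {d} → (c ∘ φ) [ i ≔ c w ] ≋ d → c ∘ φ [ i ≔ w ] ≋ d
    subst-≗ (p , q) =
      (λ {a} {b} → p ∘ proj₁ (≗⇒≋ pointwise) {a} {b}) ,
      (λ {a} {b} eq → proj₂ (≗⇒≋ pointwise) {a} {b} (q eq))

-- The frontier suffices. If the edge of a shift is taken, the new vertex has the class of the old
-- one and stands for it; if not, another frontier vertex of that class does, and if there is none,
-- the count is zero.
count-sweep : ∀ p {c : V → ℕ} {φ : Fin k → V} {ws} → shifts p ≡ length ws → Untouched c φ ws →
  count (indicator ∘ agree? (active φ ws)) (sweep p φ ws) c ≡ value p (c ∘ φ)
count-sweep [] {c} {φ} {[]} _ U =
  indicator-cong (agree? (active φ []) c) (agree? (allFin _) (c ∘ φ))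
  (λ agree {i} {j} _ _ → agree (frontier-∈ φ i) (frontier-∈ φ j))
  (λ agree {x} {y} → λ x∈ y∈ → active-elim {P = λ x → c x ≡ c y} φ
    (λ i → active-elim {P = λ y → c (φ i) ≡ c y} φ
      (λ j → agree (∈-allFin i) (∈-allFin j)) (λ ()) y∈) (λ ()) x∈)
count-sweep (join i j ∷ p) {c} {φ} {ws} len U = begin
  count P (sweep p φ ws) c +
    (if c (φ i) ≡ᵇ c (φ j) then + 0 else count P (sweep p φ ws) (glue c (φ i) (φ j)))
    ≡⟨ cong₂ _+_ (count-sweep p len U)
         (cong (if c (φ i) ≡ᵇ c (φ j) then + 0 else_) (count-sweep p len (untouched-glue i j U))) ⟩
  value p (c ∘ φ) + (if c (φ i) ≡ᵇ c (φ j) then + 0 else value p (glue (c ∘ φ) i j))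
    ≡⟨ run-join i j p _ (c ∘ φ) ⟨
  value (join i j ∷ p) (c ∘ φ)
    ∎
  where
  open ≡-Reasoning
  P = indicator ∘ agree? (active φ ws)
count-sweep (shift i ∷ p) {c} {φ} {w ∷ ws} len U = begin
  count P rest c + (if c (φ i) ≡ᵇ c w then + 0 else count P rest (glued i U))
    ≡⟨ cong (_+_ (count P rest c)) crossing ⟩
  count P rest c + value p (c ∘ φ)
    -- `count` puts the refused edge first, `successors` the accepted one.
    ≡⟨ ℤ.+-comm (count P rest c) _ ⟩
  value p (c ∘ φ) + count P rest c
    ≡⟨ skipping ⟩
  value (shift i ∷ p) (c ∘ φ)
    ∎
  where
  open ≡-Reasoning
  P    = indicator ∘ agree? (active φ (w ∷ ws))
  rest = sweep p (φ [ i ≔ w ]) ws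
  len′ = ℕ.suc-injective len

  keep : ∀ {d y} → y ∈ active (φ [ i ≔ w ]) ws → d (φ i) ≡ d y →
         count P rest d ≡ count (indicator ∘ agree? (active (φ [ i ≔ w ]) ws)) rest d
  keep y∈ eq = count-cong rest λ d′ d⊑d′ → agree-shift φ i w ws d′ y∈ (d⊑d′ eq)

  crossing : (if c (φ i) ≡ᵇ c w then + 0 else count P rest (glued i U)) ≡ value p (c ∘ φ)
  crossing with c (φ i) ≡ᵇ c w | ≡ᵇ-reflects (c (φ i)) (c w)
  ... | true  | ofʸ eq = contradiction (sym eq) (separate U i (here refl))
  ... | false | _      = trans (keep (w∈shifted φ i w ws) (glue-ends c (φ i) w))
    (trans (count-sweep p len′ (untouched-glued i U)) (value-≋ p (≗⇒≋ (glued-frontier i U))))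

  skipping : value p (c ∘ φ) + count P rest c ≡ value (shift i ∷ p) (c ∘ φ)
  skipping with shared? (c ∘ φ) i
  ... | yes s@(j , j≢i , eq) = begin
    value p (c ∘ φ) + count P rest c
      ≡⟨ cong (_+_ (value p (c ∘ φ))) (trans (keep (kept∈shifted φ i w ws j j≢i) (sym eq))
           (trans (count-sweep p len′ (untouched-drop i U)) (value-≋ p (dropped-frontier i U)))) ⟩
    value p (c ∘ φ) + value p ((c ∘ φ) [ i ≔ fresh (c ∘ φ) ])
      ≡⟨ cong (_+_ (value p (c ∘ φ))) (ℤ.+-identityʳ _) ⟨
    value p (c ∘ φ) + (value p ((c ∘ φ) [ i ≔ fresh (c ∘ φ) ]) + + 0)
      ∎
  ... | no ¬s = cong (_+_ (value p (c ∘ φ))) (count-isolated rest (sweep-active p (φ [ i ≔ w ]) ws)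
    (λ d isolated → indicator-no (agree? (active φ (w ∷ ws)) d)
      λ agree → isolated (w∈shifted φ i w ws) (agree (waiting-∈ φ (here refl)) (frontier-∈ φ i)))
    (active-elim (φ [ i ≔ w ])
      (update-elim (λ _ x → c x ≢ c (φ i)) (separate U i (here refl)) λ j j≢i eq →
        ¬s (j , j≢i , eq))
      (λ x∈ → separate U i (there x∈))))
    where
    indicator-no : ∀ {A : Set} (A? : Dec A) → ¬ A → indicator A? ≡ + 0
    indicator-no (yes a) ¬a = contradiction a ¬a
    indicator-no (no _)  _  = refl

-- The grid, column by column

∣m-n∣≡1⇒adjacent : ∀ m n → ∣ m - n ∣ ≡ 1 → n ≡ suc m ⊎ m ≡ suc n
∣m-n∣≡1⇒adjacent zero    n       eq = inj₁ eq
∣m-n∣≡1⇒adjacent (suc m) zero    eq = inj₂ eq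
∣m-n∣≡1⇒adjacent (suc m) (suc n) eq = Sum.map (cong suc) (cong suc) (∣m-n∣≡1⇒adjacent m n eq)

m+n≡1 : ∀ m n → m ℕ.+ n ≡ 1 → m ≡ 0 × n ≡ 1 ⊎ m ≡ 1 × n ≡ 0
m+n≡1 zero          n       eq = inj₁ (refl , eq)
m+n≡1 (suc zero)    zero    eq = inj₂ (refl , refl)

consecutive : ∀ {l} (i j : Fin (suc l)) → toℕ j ≡ suc (toℕ i) → ∃[ h ] i ≡ inject₁ h × j ≡ suc h
consecutive i (suc h) eq =
  h , toℕ-injective (trans (sym (ℕ.suc-injective eq)) (sym (toℕ-inject₁ h))) , refl

module ByColumn {k n : ℕ} {Vertex : Set} (column : Fin n → Fin (suc k) → Vertex)
  (column-injective : ∀ {i i′ j j′} → column j i ≡ column j′ i′ → i ≡ i′ × j ≡ j′) where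

  private
    same-row : ∀ {i i′ j j′} → column j i ≡ column j′ i′ → i ≡ i′
    same-row = proj₁ ∘ column-injective

    same-column : ∀ {i i′ j j′} → column j i ≡ column j′ i′ → j ≡ j′
    same-column = proj₂ ∘ column-injective

  step : Fin n → Fin k → Vertex × Vertex
  step j i = column j (inject₁ i) , column j (suc i)

  hop : Fin n → Fin n → Fin (suc k) → Vertex × Vertex
  hop j j′ i = column j i , column j′ i

  vertical : Fin n → List (Vertex × Vertex)
  vertical j = tabulate (step j)

  horizontal : Fin n → Fin n → List (Vertex × Vertex)
  horizontal j j′ = tabulate (hop j j′)

  vertical⁻ : ∀ j {e} → e ∈ vertical j → ∃ λ i → e ≡ step j i
  vertical⁻ j = ∈-tabulate⁻ {f = step j}

  horizontal⁻ : ∀ j j′ {e} → e ∈ horizontal j j′ → ∃ λ i → e ≡ hop j j′ i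
  horizontal⁻ j j′ = ∈-tabulate⁻ {f = hop j j′}

  -- The selection `f` lets the induction pass to the later columns as `f ∘ suc` without changing
  -- the vertex type. The order is the one in which `columns` offers the edges.
  edgesByColumn : ∀ {l} → (Fin (suc l) → Fin n) → List (Vertex × Vertex)
  edgesByColumn {zero}  f = vertical (f zero)
  edgesByColumn {suc l} f =
    vertical (f zero) ++ horizontal (f zero) (f (suc zero)) ++ edgesByColumn (f ∘ suc)

  laterColumns : ∀ {l} → (Fin (suc l) → Fin n) → List Vertex
  laterColumns {zero}  f = []
  laterColumns {suc l} f = tabulate (column (f (suc zero))) ++ laterColumns (f ∘ suc)

  laterColumns⁻ : ∀ {l} (f : Fin (suc l) → Fin n) {x} → x ∈ laterColumns f →
                  ∃₂ λ i j → x ≡ column (f (suc j)) i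
  laterColumns⁻ {suc l} f x∈ with ∈-++⁻ (tabulate (column (f (suc zero)))) x∈
  ... | inj₁ x∈₁ = let i , eq = ∈-tabulate⁻ {f = column (f (suc zero))} x∈₁ in i , zero , eq
  ... | inj₂ x∈₂ = let i , j , eq = laterColumns⁻ (f ∘ suc) x∈₂ in i , suc j , eq

  laterColumns⁺ : ∀ {l} (f : Fin (suc l) → Fin n) i j → column (f (suc j)) i ∈ laterColumns f
  laterColumns⁺ {suc l} f i zero    = ∈-++⁺ˡ (∈-tabulate⁺ {f = column (f (suc zero))} i)
  laterColumns⁺ {suc l} f i (suc j) =
    ∈-++⁺ʳ (tabulate (column (f (suc zero)))) (laterColumns⁺ (f ∘ suc) i j)

  laterColumns-unique : ∀ {l} (f : Fin (suc l) → Fin n) → (∀ {i j} → f i ≡ f j → i ≡ j) →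
    Unique (laterColumns f)
  laterColumns-unique {zero}  f inj = []
  laterColumns-unique {suc l} f inj = Unique.++⁺
    (Unique.tabulate⁺ {f = column (f (suc zero))} same-row)
    (laterColumns-unique (f ∘ suc) (Fin.suc-injective ∘ inj))
    λ (x∈ , x∈′) →
      disjoint (∈-tabulate⁻ {f = column (f (suc zero))} x∈) (laterColumns⁻ (f ∘ suc) x∈′)
    where
    disjoint : ∀ {x} → (∃ λ i → x ≡ column (f (suc zero)) i) →
      ¬ ∃₂ λ i j → x ≡ column (f (suc (suc j))) i
    disjoint (i , refl) (i′ , j , eq) with () ← inj (same-column eq)

  data InColumns {l} (f : Fin (suc l) → Fin n) : Vertex × Vertex → Set where
    down   : ∀ i j → InColumns f (step (f j) i)
    across : ∀ i j → InColumns f (hop (f (inject₁ j)) (f (suc j)) i)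

  edgesByColumn⁻ : ∀ {l} (f : Fin (suc l) → Fin n) {e} → e ∈ edgesByColumn f → InColumns f e
  edgesByColumn⁻ {zero}  f e∈ with i , refl ← vertical⁻ _ e∈ = down i zero
  edgesByColumn⁻ {suc l} f e∈ with ∈-++⁻ (vertical (f zero)) e∈
  ... | inj₁ e∈₁ with i , refl ← vertical⁻ _ e∈₁ = down i zero
  ... | inj₂ e∈₂ with ∈-++⁻ (horizontal (f zero) (f (suc zero))) e∈₂
  ...   | inj₁ e∈₃ with i , refl ← horizontal⁻ _ _ e∈₃ = across i zero
  ...   | inj₂ e∈₄ with edgesByColumn⁻ (f ∘ suc) e∈₄
  ...     | down i j   = down i (suc j)
  ...     | across i j = across i (suc j)

  edgesByColumn⁺ : ∀ {l} (f : Fin (suc l) → Fin n) {e} → InColumns f e → e ∈ edgesByColumn f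
  edgesByColumn⁺ {zero}  f (down i zero)        = ∈-tabulate⁺ {f = step (f zero)} i
  edgesByColumn⁺ {suc l} f (down i zero)        = ∈-++⁺ˡ (∈-tabulate⁺ {f = step (f zero)} i)
  edgesByColumn⁺ {suc l} f (down i (suc j))     = ∈-++⁺ʳ (vertical (f zero))
    (∈-++⁺ʳ (horizontal (f zero) (f (suc zero))) (edgesByColumn⁺ (f ∘ suc) (down i j)))
  edgesByColumn⁺ {suc l} f (across i zero)      =
    ∈-++⁺ʳ (vertical (f zero)) (∈-++⁺ˡ (∈-tabulate⁺ {f = hop (f zero) (f (suc zero))} i))
  edgesByColumn⁺ {suc l} f (across i (suc j))   = ∈-++⁺ʳ (vertical (f zero))
    (∈-++⁺ʳ (horizontal (f zero) (f (suc zero))) (edgesByColumn⁺ (f ∘ suc) (across i j)))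

  vertical-unique : ∀ j → Unique (vertical j)
  vertical-unique j = Unique.tabulate⁺ {f = step j} λ eq →
    Fin.suc-injective (same-row (proj₂ (Product.,-injective eq)))

  horizontal-unique : ∀ j j′ → Unique (horizontal j j′)
  horizontal-unique j j′ = Unique.tabulate⁺ {f = hop j j′} λ eq →
    same-row (proj₁ (Product.,-injective eq))

  edgesByColumn-unique : ∀ {l} (f : Fin (suc l) → Fin n) → (∀ {i j} → f i ≡ f j → i ≡ j) →
    Unique (edgesByColumn f)
  edgesByColumn-unique {zero}  f inj = vertical-unique (f zero)
  edgesByColumn-unique {suc l} f inj = Unique.++⁺ (vertical-unique (f zero))
    (Unique.++⁺ (horizontal-unique (f zero) (f (suc zero)))
      (edgesByColumn-unique (f ∘ suc) (Fin.suc-injective ∘ inj))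
      λ (e∈ , e∈′) → later (horizontal-start (horizontal⁻ _ _ e∈)) (edgesByColumn⁻ (f ∘ suc) e∈′))
    λ (e∈ , e∈′) → Sum.[ (λ h → vertical≢horizontal (vertical⁻ _ e∈) (horizontal⁻ _ _ h))
                       , (λ h → later (vertical-start (vertical⁻ _ e∈))
                         (edgesByColumn⁻ (f ∘ suc) h)) ]
                    (∈-++⁻ (horizontal (f zero) (f (suc zero))) e∈′)
    where
    Starts : Vertex × Vertex → Set
    Starts e = ∃ λ i → proj₁ e ≡ column (f zero) i

    later : ∀ {e} → Starts e → ¬ InColumns (f ∘ suc) e
    later (i , eq) (down i′ j)   with () ← inj (same-column eq)
    later (i , eq) (across i′ j) with () ← inj (same-column eq)

    vertical-start : ∀ {e} → (∃ λ i → e ≡ step (f zero) i) → Starts e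
    vertical-start (i , refl) = inject₁ i , refl

    horizontal-start : ∀ {e} → (∃ λ i → e ≡ hop (f zero) (f (suc zero)) i) → Starts e
    horizontal-start (i , refl) = i , refl

    vertical≢horizontal : ∀ {e} → (∃ λ i → e ≡ step (f zero) i) →
      ¬ ∃ λ i → e ≡ hop (f zero) (f (suc zero)) i
    vertical≢horizontal (i , refl) (i′ , eq)
      with () ← inj (same-column (proj₂ (Product.,-injective eq)))

module _ (k n : ℕ) where

  cell : Fin (suc n) → Fin (suc k) → Fin (suc k ℕ.* suc n)
  cell j i = combine i j

  cell-injective : ∀ {i i′ j j′} → cell j i ≡ cell j′ i′ → i ≡ i′ × j ≡ j′
  cell-injective {i} {i′} {j} {j′} = combine-injective i j i′ j′

  open ByColumn cell cell-injective

  private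
    G = gridGraph (suc k) (suc n)
    open SimpleGraph G

  cells-distance : ∀ (i i′ : Fin (suc k)) (j j′ : Fin (suc n)) →
    (combine i j ~ combine i′ j′) ≡ (∣ toℕ i - toℕ i′ ∣ ℕ.+ ∣ toℕ j - toℕ j′ ∣ ≡ 1)
  cells-distance i i′ j j′ = cong₂
    (λ (a , b) (c , d) → ∣ toℕ a - toℕ c ∣ ℕ.+ ∣ toℕ b - toℕ d ∣ ≡ 1)
    (remQuot-combine {suc k} {suc n} i j) (remQuot-combine {suc k} {suc n} i′ j′)

  ∣n-1+n∣≡1 : ∀ m → ∣ m - suc m ∣ ≡ 1
  ∣n-1+n∣≡1 zero    = refl
  ∣n-1+n∣≡1 (suc m) = ∣n-1+n∣≡1 m

  column-< : ∀ (i : Fin (suc k)) {j j′ : Fin (suc n)} → j Fin.< j′ → combine i j Fin.< combine i j′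
  column-< i {j} {j′} j<j′ = subst₂ ℕ._<_ (sym (toℕ-combine i j)) (sym (toℕ-combine i j′))
    (ℕ.+-monoʳ-< (suc n ℕ.* toℕ i) j<j′)

  grid-edge⁺ : ∀ {u v} → InColumns id (u , v) → u Fin.< v × u ~ v
  grid-edge⁺ (down i j) = combine-monoˡ-< j j i<1+i ,
    subst id (sym (cells-distance (inject₁ i) (suc i) j j))
      (cong₂ ℕ._+_ (trans (cong (λ x → ∣ x - suc (toℕ i) ∣) (toℕ-inject₁ i)) (∣n-1+n∣≡1 (toℕ i)))
                   (ℕ.∣n-n∣≡0 (toℕ j)))
    where
    i<1+i : inject₁ i Fin.< suc i
    i<1+i = ℕ.≤-reflexive (cong suc (toℕ-inject₁ i))
  grid-edge⁺ (across i j) = column-< i j<1+j ,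
    subst id (sym (cells-distance i i (inject₁ j) (suc j)))
      (cong₂ ℕ._+_ (ℕ.∣n-n∣≡0 (toℕ i))
                   (trans (cong (λ x → ∣ x - suc (toℕ j) ∣) (toℕ-inject₁ j)) (∣n-1+n∣≡1 (toℕ j))))
    where
    j<1+j : inject₁ j Fin.< suc j
    j<1+j = ℕ.≤-reflexive (cong suc (toℕ-inject₁ j))

  neighbours : ∀ (i i′ : Fin (suc k)) (j j′ : Fin (suc n)) → combine i j Fin.< combine i′ j′ →
    ∣ toℕ i - toℕ i′ ∣ ≡ 0 × ∣ toℕ j - toℕ j′ ∣ ≡ 1 ⊎
    ∣ toℕ i - toℕ i′ ∣ ≡ 1 × ∣ toℕ j - toℕ j′ ∣ ≡ 0 →
    InColumns id (combine i j , combine i′ j′)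
  neighbours i i′ j j′ < (inj₁ (i≡ , j≡))
    with refl ← toℕ-injective {i = i} {i′} (ℕ.∣m-n∣≡0⇒m≡n i≡) | ∣m-n∣≡1⇒adjacent (toℕ j) (toℕ j′) j≡
  ... | inj₁ next with h , refl , refl ← consecutive j j′ next = across i h
  ... | inj₂ prev = contradiction (column-< i (ℕ.≤-reflexive (sym prev))) (Fin.<-asym <)
  neighbours i i′ j j′ < (inj₂ (i≡ , j≡))
    with refl ← toℕ-injective {i = j} {j′} (ℕ.∣m-n∣≡0⇒m≡n j≡) | ∣m-n∣≡1⇒adjacent (toℕ i) (toℕ i′) i≡
  ... | inj₁ next with h , refl , refl ← consecutive i i′ next = down h j
  ... | inj₂ prev = contradiction (combine-monoˡ-< j j (ℕ.≤-reflexive (sym prev))) (Fin.<-asym <)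

  grid-edge⁻ : ∀ {u v} → u Fin.< v → u ~ v → InColumns id (u , v)
  grid-edge⁻ {u} {v} u<v u~v
    with i , j , refl ← combine-surjective {suc k} {suc n} u
       | i′ , j′ , refl ← combine-surjective {suc k} {suc n} v =
    neighbours i i′ j j′ u<v
      (m+n≡1 ∣ toℕ i - toℕ i′ ∣ ∣ toℕ j - toℕ j′ ∣ (subst id (cells-distance i i′ j j′) u~v))

  -- `edges` follows the row-by-row numbering, whereas the sweep runs by columns. Duplicate-free
  -- lists with the same members are permutations of each other.
  edges-↭ : edges G ↭ edgesByColumn id
  edges-↭ = ∼bag⇒↭ (unique∧set⇒bag (edges-unique G) (edgesByColumn-unique id id) (mk⇔ to from))
    where
    test? = λ ((u , v) : Fin (suc k ℕ.* suc n) × Fin (suc k ℕ.* suc n)) →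
      (u Fin.<? v) ×-dec (u ~? v)

    to : ∀ {e} → e ∈ edges G → e ∈ edgesByColumn id
    to e∈
      with u<v , u~v ← proj₂ (∈-filter⁻ test? {xs = cartesianProduct (allFin _) (allFin _)} e∈) =
      edgesByColumn⁺ id (grid-edge⁻ u<v u~v)

    from : ∀ {e} → e ∈ edgesByColumn id → e ∈ edges G
    from e∈ = ∈-filter⁺ test? (∈-cartesianProduct⁺ (∈-allFin _) (∈-allFin _))
      (grid-edge⁺ (edgesByColumn⁻ id e∈))

sweep-cong : ∀ {k} {V : Set} (p : List (Op k)) {φ ψ : Fin k → V} ws → φ ≗ ψ →
  sweep p φ ws ≡ sweep p ψ ws
sweep-cong []             ws       eq = refl
sweep-cong (join i j ∷ p) ws       eq = cong₂ _∷_ (cong₂ _,_ (eq i) (eq j)) (sweep-cong p ws eq)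
sweep-cong (shift i ∷ p)  []       eq = refl
sweep-cong (shift i ∷ p) {φ} {ψ} (w ∷ ws) eq = cong₂ _∷_ (cong (_, w) (eq i))
  (sweep-cong p ws (update-elim (λ j x → x ≡ (ψ [ i ≔ w ]) j) (sym (updateAt-updates i ψ))
    λ j j≢i → trans (eq j) (sym (updateAt-minimal j i ψ j≢i))))

joins : List (Op 7)
joins = tabulate {n = 6} λ i → join (inject₁ i) (suc i)

shiftAll : List (Op 7)
shiftAll = tabulate shift

columns : ℕ → List (Op 7)
columns zero    = joins
columns (suc l) = joins ++ shiftAll ++ columns l

module _ {n : ℕ} {V : Set} (column : Fin n → Fin 7 → V)
  (column-injective : ∀ {i i′ j j′} → column j i ≡ column j′ i′ → i ≡ i′ × j ≡ j′) where

  open ByColumn column column-injective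

  sweep-columns : ∀ {l} (f : Fin (suc l) → Fin n) →
    sweep (columns l) (column (f zero)) (laterColumns f) ≡ edgesByColumn f
  sweep-columns {zero}  f = refl
  sweep-columns {suc l} f =
    cong (λ es → vertical (f zero) ++ horizontal (f zero) (f (suc zero)) ++ es)
    (trans (sweep-cong (columns l) (laterColumns (f ∘ suc)) shifted) (sweep-columns (f ∘ suc)))
    where
    ψ = column (f (suc zero))

    -- Seven updates replace the whole frontier. The equality is pointwise, hence the passage
    -- through `sweep-cong`.
    shifted : column (f zero) [ 0F ≔ ψ 0F ] [ 1F ≔ ψ 1F ] [ 2F ≔ ψ 2F ] [ 3F ≔ ψ 3F ]
                              [ 4F ≔ ψ 4F ] [ 5F ≔ ψ 5F ] [ 6F ≔ ψ 6F ] ≗ ψ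
    shifted 0F = refl
    shifted 1F = refl
    shifted 2F = refl
    shifted 3F = refl
    shifted 4F = refl
    shifted 5F = refl
    shifted 6F = refl

  shifts-columns : ∀ {l} (f : Fin (suc l) → Fin n) → shifts (columns l) ≡ length (laterColumns f)
  shifts-columns {zero}  f = refl
  shifts-columns {suc l} f = cong (7 ℕ.+_) (shifts-columns (f ∘ suc))

module _ {n : ℕ} {V : Set} (column : Fin (suc n) → Fin 7 → V)
  (column-injective : ∀ {i i′ j j′} → column j i ≡ column j′ i′ → i ≡ i′ × j ≡ j′)
  (cover : ∀ x → ∃₂ λ i j → x ≡ column j i) {vs : List V} (listed : ∀ x → x ∈ vs)
  {label : V → ℕ} (label-injective : ∀ {x y} → label x ≡ label y → x ≡ y) where

  open ByColumn column column-injective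

  private
    φ  = column zero
    ws = laterColumns id

  all-active : ∀ x → x ∈ active φ ws
  all-active x with cover x
  ... | i , zero  , refl = frontier-∈ φ i
  ... | i , suc j , refl = waiting-∈ φ (laterColumns⁺ id i j)

  all-untouched : Untouched label φ ws
  all-untouched = record
    { unique    = laterColumns-unique id id
    ; injective = λ _ _ → label-injective
    ; separate  = λ i x∈ eq → elsewhere i (laterColumns⁻ id x∈) (label-injective eq)
    }
    where
    elsewhere : ∀ {x} i → (∃₂ λ i′ j → x ≡ column (suc j) i′) → x ≢ φ i
    elsewhere i (i′ , j , refl) eq with () ← proj₂ (column-injective eq)

  count-columns : count (indicator ∘ agree? vs) (edgesByColumn id) label ≡ value (columns n) toℕ
  count-columns = begin
    count (indicator ∘ agree? vs) (edgesByColumn id) label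
      ≡⟨ cong (λ es → count (indicator ∘ agree? vs) es label)
        (sweep-columns column column-injective id) ⟨
    count (indicator ∘ agree? vs) (sweep (columns n) φ ws) label
      ≡⟨ count-cong (sweep (columns n) φ ws) (λ d _ →
        indicator-cong (agree? vs d) (agree? (active φ ws) d)
           (λ agree _ _ → agree (listed _) (listed _))
           (λ agree {x} {y} _ _ → agree (all-active x) (all-active y))) ⟩
    count (indicator ∘ agree? (active φ ws)) (sweep (columns n) φ ws) label
      ≡⟨ count-sweep (columns n) (shifts-columns column column-injective id) all-untouched ⟩
    value (columns n) (label ∘ φ)
      -- The labels are injective, so up to `≋` the first column starts as the discrete partition
      -- `toℕ`.
      ≡⟨ value-≋ (columns n) ((λ eq → cong toℕ (proj₁ (column-injective (label-injective eq)))) ,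
                              (λ eq → cong (label ∘ φ) (toℕ-injective eq))) ⟩
    value (columns n) toℕ
      ∎
    where open ≡-Reasoning

s-value : ∀ n → + s 7 (suc n) ≡ value (columns n) toℕ
s-value n = trans (length-spanningTrees (gridGraph 7 (suc n)))
  (trans (count-↭ (agree-invariant (allFin _)) (edges-↭ 6 n) toℕ)
         (count-columns (cell 6 n) (cell-injective 6 n) cover ∈-allFin toℕ-injective))
  where
  cover : ∀ x → ∃₂ λ i j → x ≡ cell 6 n j i
  cover x = let i , j , eq = combine-surjective {7} {suc n} x in i , j , sym eq

-- Power series

⊛-cong-≤ : ∀ (f f′ g g′ : PowerSeries) n → (∀ m → m ≤ n → f m ≡ f′ m) →
           (∀ m → m ≤ n → g m ≡ g′ m) → (f ⊛ g) n ≡ (f′ ⊛ g′) n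
⊛-cong-≤ f f′ g g′ zero f≡ g≡ = cong₂ (λ a b → a * b + + 0) (f≡ 0 z≤n) (g≡ 0 z≤n)
⊛-cong-≤ f f′ g g′ (suc n) f≡ g≡ = cong₂ _+_ (cong₂ _*_ (f≡ 0 z≤n) (g≡ (suc n) ℕ.≤-refl))
  (⊛-cong-≤ (f ∘ suc) (f′ ∘ suc) g g′ n (λ m m≤n → f≡ (suc m) (s≤s m≤n)) (λ m m≤n →
    g≡ m (ℕ.m≤n⇒m≤1+n m≤n)))

⊛-suc : ∀ f g n → (f ⊛ g) (suc n) ≡ (f ⊛ (g ∘ suc)) n + f (suc n) * g 0
⊛-suc f g zero = rearrange (f 0 * g 1) (f 1 * g 0)
  where
  rearrange : ∀ a b → a + (b + + 0) ≡ (a + + 0) + b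
  rearrange = solve-∀
⊛-suc f g (suc n) = trans (cong (_+_ (f 0 * g (suc (suc n)))) (⊛-suc (f ∘ suc) g n))
  (sym (ℤ.+-assoc (f 0 * g (suc (suc n))) _ _))

⊛-comm : ∀ f g → f ⊛ g ≗ g ⊛ f
⊛-comm f g zero    = cong (_+ + 0) (ℤ.*-comm (f 0) (g 0))
⊛-comm f g (suc n) = begin
  f 0 * g (suc n) + ((f ∘ suc) ⊛ g) n  ≡⟨ ℤ.+-comm (f 0 * g (suc n)) _ ⟩
  ((f ∘ suc) ⊛ g) n + f 0 * g (suc n)  ≡⟨ cong₂ _+_ (⊛-comm (f ∘ suc) g n) (ℤ.*-comm (f 0) _) ⟩
  (g ⊛ (f ∘ suc)) n + g (suc n) * f 0  ≡⟨ ⊛-suc g f n ⟨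
  (g ⊛ f) (suc n)                      ∎
  where open ≡-Reasoning

module _ (h : PowerSeries) (h₀≡1 : h 0 ≡ + 1) where

  -- Long division: this is (f - f₀h)/t, where h₀ = 1 makes the constant term of f - f₀h vanish.
  remainder : PowerSeries → PowerSeries
  remainder f n = f (suc n) - f 0 * h (suc n)

  quotient : PowerSeries → PowerSeries
  quotient f zero    = f 0
  quotient f (suc n) = quotient (remainder f) n

  quotient-cong : ∀ {f g} → f ≗ g → quotient f ≗ quotient g
  quotient-cong f≗g zero    = f≗g 0
  quotient-cong f≗g (suc n) =
    quotient-cong (λ m → cong₂ (λ a b → a - b * h (suc m)) (f≗g (suc m)) (f≗g 0)) n

  quotient-linear : ∀ f g c n →
    quotient (λ m → f m + c * g m) n ≡ quotient f n + c * quotient g n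
  quotient-linear f g c zero    = refl
  quotient-linear f g c (suc n) = trans
    (quotient-cong (λ m → rearrange (f (suc m)) (f 0) (g (suc m)) (g 0) c (h (suc m))) n)
    (quotient-linear (remainder f) (remainder g) c n)
    where
    rearrange : ∀ f′ f₀ g′ g₀ c h →
      (f′ + c * g′) - (f₀ + c * g₀) * h ≡ (f′ - f₀ * h) + c * (g′ - g₀ * h)
    rearrange = solve-∀

  quotient-⊛ : ∀ f → quotient f ⊛ h ≗ f
  quotient-⊛ f zero    = trans (cong (λ x → f 0 * x + + 0) h₀≡1) (unit (f 0))
    where
    unit : ∀ a → a * + 1 + + 0 ≡ a
    unit = solve-∀
  quotient-⊛ f (suc n) = trans (cong (_+_ (f 0 * h (suc n))) (quotient-⊛ (remainder f) n))
    (cancel (f 0 * h (suc n)) (f (suc n)))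
    where
    cancel : ∀ a b → a + (b - a) ≡ b
    cancel = solve-∀

  ⊛-quotient : ∀ f → quotient (f ⊛ h) ≗ f
  ⊛-quotient f zero    = trans (cong (λ x → f 0 * x + + 0) h₀≡1) (unit (f 0))
    where
    unit : ∀ a → a * + 1 + + 0 ≡ a
    unit = solve-∀
  ⊛-quotient f (suc n) = trans (quotient-cong shifted n) (⊛-quotient (f ∘ suc) n)
    where
    cancel : ∀ a x b → (a * x + b) - (a * + 1 + + 0) * x ≡ b
    cancel = solve-∀

    shifted : remainder (f ⊛ h) ≗ (f ∘ suc) ⊛ h
    shifted m = trans
      (cong (λ y → (f 0 * h (suc m) + ((f ∘ suc) ⊛ h) m) - (f 0 * y + + 0) * h (suc m)) h₀≡1)
      (cancel (f 0) (h (suc m)) _)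

  inverse : PowerSeries
  inverse = quotient one

  -- Linearity of the division by `h` does here the work of associativity of `⊛`.
  ⊛-inverse : ∀ f → f ⊛ inverse ≗ quotient f
  ⊛-inverse f zero    = unit (f 0)
    where
    unit : ∀ a → a * + 1 + + 0 ≡ a
    unit = solve-∀
  ⊛-inverse f (suc n) = begin
    f 0 * inverse (suc n) + ((f ∘ suc) ⊛ inverse) n
      ≡⟨ cong₂ (λ a b → f 0 * a + b) inverse-suc (⊛-inverse (f ∘ suc) n) ⟩
    f 0 * (quotient (λ _ → + 0) n + - + 1 * quotient (h ∘ suc) n) + quotient (f ∘ suc) n
      ≡⟨ cong (λ z → f 0 * (z + - + 1 * quotient (h ∘ suc) n) + quotient (f ∘ suc) n)
        (quotient-zero n) ⟩
    f 0 * (+ 0 + - + 1 * quotient (h ∘ suc) n) + quotient (f ∘ suc) n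
      ≡⟨ rearrange (f 0) (quotient (h ∘ suc) n) (quotient (f ∘ suc) n) ⟩
    quotient (f ∘ suc) n + (- f 0) * quotient (h ∘ suc) n
      ≡⟨ quotient-linear (f ∘ suc) (h ∘ suc) (- f 0) n ⟨
    quotient (λ m → f (suc m) + (- f 0) * h (suc m)) n
      ≡⟨ quotient-cong (λ m → cong (_+_ (f (suc m))) (sym (ℤ.neg-distribˡ-* (f 0) (h (suc m))))) n ⟩
    quotient (remainder f) n
      ∎
    where
    open ≡-Reasoning

    rearrange : ∀ a b c → a * (+ 0 + - + 1 * b) + c ≡ c + (- a) * b
    rearrange = solve-∀

    neg : ∀ a → + 0 - + 1 * a ≡ + 0 + - + 1 * a
    neg = solve-∀

    inverse-suc : inverse (suc n) ≡ quotient (λ _ → + 0) n + - + 1 * quotient (h ∘ suc) n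
    inverse-suc = trans (quotient-cong (λ m → neg (h (suc m))) n)
      (quotient-linear (λ _ → + 0) (h ∘ suc) (- + 1) n)

    quotient-zero : ∀ n → quotient (λ _ → + 0) n ≡ + 0
    quotient-zero zero    = refl
    quotient-zero (suc n) = trans (quotient-cong (λ m → vanish (h (suc m))) n) (quotient-zero n)
      where
      vanish : ∀ a → + 0 - + 0 * a ≡ + 0
      vanish = solve-∀

  fraction : ∀ {f g} → h ⊛ f ≗ g → f ≈ g / h
  fraction {f} {g} hf≗g =
    inverse , (λ n → trans (⊛-comm h inverse n) (quotient-⊛ one n)) , λ n → begin
    f n                ≡⟨ ⊛-quotient f n ⟨
    quotient (f ⊛ h) n ≡⟨ quotient-cong (λ m → trans (⊛-comm f h m) (hf≗g m)) n ⟩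
    quotient g n       ≡⟨ ⊛-inverse g n ⟨
    (g ⊛ inverse) n    ∎
    where open ≡-Reasoning

-- Linear recurrences

window : List ℤ → (ℕ → ℤ) → ℕ → ℤ
window []       a m = + 0
window (c ∷ cs) a m = c * a m + window cs a (suc m)

window-snoc : ∀ cs c a m → window (cs ++ c ∷ []) a m ≡ window cs a m + c * a (m ℕ.+ length cs)
window-snoc [] c a m =
  trans (ℤ.+-comm (c * a m) (+ 0)) (cong (λ i → + 0 + c * a i) (sym (ℕ.+-identityʳ m)))
window-snoc (d ∷ cs) c a m = trans
  (cong (_+_ (d * a m)) (trans (window-snoc cs c a (suc m))
    (cong (λ i → window cs a (suc m) + c * a i) (sym (ℕ.+-suc m (length cs))))))
  (sym (ℤ.+-assoc (d * a m) _ _))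

zero-⊛ : ∀ a m → (polynomial [] ⊛ a) m ≡ + 0
zero-⊛ a zero    = refl
zero-⊛ a (suc m) = trans (ℤ.+-identityˡ _) (zero-⊛ a m)

-- From the index `length cs`, the formal degree, onwards the convolution involves all coefficients;
-- the constant one meets the latest value, hence `reverse`.
polynomial-⊛ : ∀ c cs a m →
  (polynomial (c ∷ cs) ⊛ a) (length cs ℕ.+ m) ≡ window (reverse (c ∷ cs)) a m
polynomial-⊛ c [] a m = head-only m
  where
  head-only : ∀ m → (polynomial (c ∷ []) ⊛ a) m ≡ c * a m + + 0
  head-only zero    = refl
  head-only (suc m) = cong (_+_ (c * a (suc m))) (zero-⊛ a m)
polynomial-⊛ c (d ∷ cs) a m = begin
  c * a n + (polynomial (d ∷ cs) ⊛ a) (length cs ℕ.+ m)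
    ≡⟨ cong₂ (λ i w → c * a i + w) shifted (polynomial-⊛ d cs a m) ⟩
  c * a (m ℕ.+ length (reverse (d ∷ cs))) + window (reverse (d ∷ cs)) a m
    ≡⟨ ℤ.+-comm (c * a (m ℕ.+ length (reverse (d ∷ cs)))) _ ⟩
  window (reverse (d ∷ cs)) a m + c * a (m ℕ.+ length (reverse (d ∷ cs)))
    ≡⟨ window-snoc (reverse (d ∷ cs)) c a m ⟨
  window (reverse (d ∷ cs) ++ c ∷ []) a m
    ≡⟨ cong (λ xs → window xs a m) (unfold-reverse c (d ∷ cs)) ⟨
  window (reverse (c ∷ d ∷ cs)) a m
    ∎
  where
  open ≡-Reasoning
  n = suc (length cs ℕ.+ m)

  shifted : n ≡ m ℕ.+ length (reverse (d ∷ cs))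
  shifted = trans (ℕ.+-comm (suc (length cs)) m) (cong (m ℕ.+_) (sym (length-reverse (d ∷ cs))))

polynomial-⊛-beyond : ∀ cs a m →
  (polynomial cs ⊛ a) (length cs ℕ.+ m) ≡ window (reverse cs) a (suc m)
polynomial-⊛-beyond []       a m = zero-⊛ a m
polynomial-⊛-beyond (c ∷ cs) a m =
  trans (cong (polynomial (c ∷ cs) ⊛ a) (sym (ℕ.+-suc (length cs) m)))
  (polynomial-⊛ c cs a (suc m))

monic-recurrence-zero : ∀ cs a → (∀ m → window (cs ++ + 1 ∷ []) a m ≡ + 0) →
  (∀ m → m < length cs → a m ≡ + 0) → ∀ m → a m ≡ + 0
monic-recurrence-zero cs a rec initial m = zeros m m ℕ.≤-refl
  where
  window-zero : ∀ cs m → (∀ i → i < length cs → a (m ℕ.+ i) ≡ + 0) → window cs a m ≡ + 0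
  window-zero []       m _ = refl
  window-zero (c ∷ cs) m z = cong₂ _+_
    (trans (cong (c *_) (trans (cong a (sym (ℕ.+-identityʳ m))) (z 0 (s≤s z≤n)))) (ℤ.*-zeroʳ c))
    (window-zero cs (suc m) λ i i< → trans (cong a (sym (ℕ.+-suc m i))) (z (suc i) (s≤s i<)))

  next : ∀ m → (∀ i → i < m ℕ.+ length cs → a i ≡ + 0) → a (m ℕ.+ length cs) ≡ + 0
  next m z = begin
    a n                          ≡⟨ unit (a n) ⟩
    + 0 + + 1 * a n              ≡⟨ cong (_+ + 1 * a n) (window-zero cs m λ i i< →
      z (m ℕ.+ i) (ℕ.+-monoʳ-< m i<)) ⟨
    window cs a m + + 1 * a n    ≡⟨ window-snoc cs (+ 1) a m ⟨
    window (cs ++ + 1 ∷ []) a m  ≡⟨ rec m ⟩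
    + 0                          ∎
    where
    open ≡-Reasoning
    n = m ℕ.+ length cs

    unit : ∀ x → x ≡ + 0 + + 1 * x
    unit = solve-∀

  below : ∀ m i → i < m ℕ.+ length cs → a i ≡ + 0
  below zero    i i<      = initial i i<
  below (suc m) i (s≤s i≤) with ℕ.m≤n⇒m<n∨m≡n i≤
  ... | inj₁ i<   = below m i i<
  ... | inj₂ refl = next m (below m)

  zeros : ∀ m i → i ≤ m → a i ≡ + 0
  zeros m i i≤m = below (suc m) i (s≤s (ℕ.≤-trans i≤m (ℕ.m≤m+n m _)))

-- Vectors indexed by non-crossing partitions

sumOver-cong : {f g : A → ℤ} → f ≗ g → sumOver f ≗ sumOver g
sumOver-cong eq xs = cong (foldr _+_ (+ 0)) (map-cong eq xs)

run-++ : ∀ (p q : List (Op k)) f → run (p ++ q) f ≗ run p (run q f)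
run-++ []      q f κ = refl
run-++ (o ∷ p) q f κ = sumOver-cong (run-++ p q f) (successors o κ)

sumOver-linear : ∀ c (f g : A → ℤ) xs →
  sumOver (λ x → c * f x + g x) xs ≡ c * sumOver f xs + sumOver g xs
sumOver-linear c f g []       = nothing c
  where
  nothing : ∀ c → + 0 ≡ c * + 0 + + 0
  nothing = solve-∀
sumOver-linear c f g (x ∷ xs) =
  trans (cong (_+_ (c * f x + g x)) (sumOver-linear c f g xs)) (rearrange c (f x) (g x) _ _)
  where
  rearrange : ∀ c a b s t → (c * a + b) + (c * s + t) ≡ c * (a + s) + (b + t)
  rearrange = solve-∀

run-linear : ∀ (p : List (Op k)) c f g κ →
  run p (λ κ → c * f κ + g κ) κ ≡ c * run p f κ + run p g κ
run-linear []      c f g κ = refl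
run-linear (o ∷ p) c f g κ = trans (sumOver-cong (run-linear p c f g) (successors o κ))
  (sumOver-linear c (run p f) (run p g) (successors o κ))

run-zero : ∀ (p : List (Op k)) κ → run p (const (+ 0)) κ ≡ + 0
run-zero []      κ = refl
run-zero (o ∷ p) κ = trans (sumOver-cong (run-zero p) (successors o κ)) (zeros (successors o κ))
  where
  zeros : ∀ (xs : List A) → sumOver (const (+ 0)) xs ≡ + 0
  zeros []       = refl
  zeros (_ ∷ xs) = trans (ℤ.+-identityˡ _) (zeros xs)

-- Orbits of a linear operator

record Orbit (p : List (Op k)) (F : ℕ → (Fin k → ℕ) → ℤ) : Set where
  field
    invariant : ∀ m → Invariant (F m)
    step      : ∀ m → run p (F m) ≗ F (suc m)

open Orbit

-- For an orbit `F`, this is the polynomial with coefficients `cs` in the operator `run p`, applied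
-- to `F m`. By linearity the result is again an orbit, so polynomials can be applied one after the
-- other.
windows : List ℤ → (ℕ → (Fin k → ℕ) → ℤ) → ℕ → (Fin k → ℕ) → ℤ
windows cs F m κ = window cs (λ l → F l κ) m

windows-orbit : ∀ {p : List (Op k)} {F} cs → Orbit p F → Orbit p (windows cs F)
windows-orbit {p = p} [] O = record { invariant = λ _ _ → refl ; step = λ _ → run-zero p }
windows-orbit {p = p} {F} (c ∷ cs) O = record
  { invariant = λ m κ≋ → cong₂ (λ a b → c * a + b) (invariant O m κ≋) (invariant rest (suc m) κ≋)
  ; step      = λ m κ → trans (run-linear p c (F m) (windows cs F (suc m)) κ)
                              (cong₂ (λ a b → c * a + b) (step O m κ) (step rest (suc m) κ))
  }
  where rest = windows-orbit cs O

-- Vectors as binary trees over the states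

data Tree (A : Set) : Set where
  leaf : A → Tree A
  node : Tree A → Tree A → Tree A

mapT : (A → B) → Tree A → Tree B
mapT f (leaf x)   = leaf (f x)
mapT f (node l r) = node (mapT f l) (mapT f r)

zipT : (A → A → A) → Tree A → Tree A → Tree A
zipT _∙_ (leaf x)   (leaf y)     = leaf (x ∙ y)
zipT _∙_ (node l r) (node l′ r′) = node (zipT _∙_ l l′) (zipT _∙_ r r′)
zipT _∙_ t          _            = t

-- A path that is too short continues to the left, and surplus steps are ignored; `Located` checks
-- that the paths in the tables lead to the intended states.
at : List Bool → Tree A → A
at _           (leaf x)   = x
at []          (node l _) = at [] l
at (false ∷ p) (node l _) = at p l
at (true ∷ p)  (node _ r) = at p r

Everywhere : (A → Set) → Tree A → Set
Everywhere P (leaf x)   = P x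
Everywhere P (node l r) = Everywhere P l × Everywhere P r

everywhere? : {P : A → Set} → (∀ x → Dec (P x)) → ∀ t → Dec (Everywhere P t)
everywhere? P? (leaf x)   = P? x
everywhere? P? (node l r) = everywhere? P? l ×-dec everywhere? P? r

mapT-cong : ∀ {f g : A → B} t → Everywhere (λ x → f x ≡ g x) t → mapT f t ≡ mapT g t
mapT-cong (leaf x)   eq        = cong leaf eq
mapT-cong (node l r) (eq , eq′) = cong₂ node (mapT-cong l eq) (mapT-cong r eq′)

mapT-≗ : ∀ {f g : A → B} → f ≗ g → mapT f ≗ mapT g
mapT-≗ eq (leaf x)   = cong leaf (eq x)
mapT-≗ eq (node l r) = cong₂ node (mapT-≗ eq l) (mapT-≗ eq r)

mapT-∘ : ∀ {C : Set} (f : B → C) (g : A → B) t → mapT f (mapT g t) ≡ mapT (f ∘ g) t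
mapT-∘ f g (leaf x)   = refl
mapT-∘ f g (node l r) = cong₂ node (mapT-∘ f g l) (mapT-∘ f g r)

at-mapT : ∀ (f : A → B) p t → at p (mapT f t) ≡ f (at p t)
at-mapT f p           (leaf x)   = refl
at-mapT f []          (node l _) = at-mapT f [] l
at-mapT f (false ∷ p) (node l _) = at-mapT f p l
at-mapT f (true ∷ p)  (node _ r) = at-mapT f p r

zipT-mapT : ∀ (_∙_ : B → B → B) (f g : A → B) t →
            zipT _∙_ (mapT f t) (mapT g t) ≡ mapT (λ x → f x ∙ g x) t
zipT-mapT _∙_ f g (leaf x)   = refl
zipT-mapT _∙_ f g (node l r) = cong₂ node (zipT-mapT _∙_ f g l) (zipT-mapT _∙_ f g r)

everywhere-map : ∀ {P Q : A → Set} → (∀ x → P x → Q x) → ∀ t → Everywhere P t → Everywhere Q t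
everywhere-map P⊆Q (leaf x)   e        = P⊆Q x e
everywhere-map P⊆Q (node l r) (e , e′) = everywhere-map P⊆Q l e , everywhere-map P⊆Q r e′

-- The non-crossing partitions of {i , … , i + r − 1} ∪ st, where st lists the blocks
-- that may still grow, innermost first.  A block is labelled by its least element,
-- and adding an element to a block closes all blocks nested inside it.
mutual
  nonCrossing : ∀ r → ℕ → List ℕ → Tree (Vec ℕ r)
  nonCrossing zero    i st = leaf []
  nonCrossing (suc r) i st = choices r i i st

  choices : ∀ r → ℕ → ℕ → List ℕ → Tree (Vec ℕ (suc r))
  choices r i l []        = mapT (l ∷_) (nonCrossing r (suc i) (l ∷ []))
  choices r i l (l′ ∷ st) =
    node (mapT (l ∷_) (nonCrossing r (suc i) (l ∷ l′ ∷ st))) (choices r i l′ st)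

mutual
  -- Retraces the branching of `nonCrossing`, one Boolean per `node`. The last candidate is taken
  -- without comparison, so the path of a crossing partition ends at a different state.
  locate : ∀ {r} → ℕ → List ℕ → Vec ℕ r → List Bool
  locate i st []       = []
  locate i st (x ∷ xs) = choose i x i st xs

  choose : ∀ {r} → ℕ → ℕ → ℕ → List ℕ → Vec ℕ r → List Bool
  choose i x l []        xs = locate (suc i) (l ∷ []) xs
  choose i x l (l′ ∷ st) xs =
    if x ≡ᵇ l then false ∷ locate (suc i) (l ∷ l′ ∷ st) xs else true ∷ choose i x l′ st xs

first : ∀ {n} → Vec ℕ n → ℕ → ℕ
first []       x = 0
first (y ∷ ys) x = if x ≡ᵇ y then 0 else suc (first ys x)

first-injective : ∀ {n} (ys : Vec ℕ n) {x z} i → Vec.lookup ys i ≡ x → first ys x ≡ first ys z →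
  x ≡ z
first-injective (y ∷ ys) {x} {z} i at-i eq
  with x ≡ᵇ y | ≡ᵇ-reflects x y | z ≡ᵇ y | ≡ᵇ-reflects z y
first-injective (y ∷ ys) i       at-i eq | true  | ofʸ p  | true  | ofʸ q = trans p (sym q)
first-injective (y ∷ ys) zero    at-i eq | false | ofⁿ ¬p | _     | _     =
  contradiction (sym at-i) ¬p
first-injective (y ∷ ys) (suc i) at-i eq | false | _      | false | _     =
  first-injective ys i at-i (ℕ.suc-injective eq)

-- The position of the first occurrence of a label is the least element of its block, the label that
-- `nonCrossing` uses.
relabel : Vec ℕ k → Vec ℕ k
relabel v = Vec.map (first v) v

canonical : (Fin k → ℕ) → Vec ℕ k
canonical κ = relabel (Vec.tabulate κ)

canonical-≋ : ∀ (κ : Fin k → ℕ) → κ ≋ Vec.lookup (canonical κ)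
canonical-≋ κ = (λ {i} {j} eq → trans (entry i) (trans (cong (first v) eq) (sym (entry j)))) ,
  λ {i} {j} eq →
    first-injective v i (Vec.lookup∘tabulate κ i) (trans (sym (entry i)) (trans eq (entry j)))
  where
  v = Vec.tabulate κ

  entry : ∀ i → Vec.lookup (canonical κ) i ≡ first v (κ i)
  entry i = trans (Vec.lookup-map i (first v) v) (cong (first v) (Vec.lookup∘tabulate κ i))

states : ∀ k → Tree (Vec ℕ k)
states k = nonCrossing k 0 []

vector : ∀ {k} → ((Fin k → ℕ) → ℤ) → Tree ℤ
vector {k} f = mapT (f ∘ Vec.lookup) (states k)

vector-cong : ∀ {f g : (Fin k → ℕ) → ℤ} → f ≗ g → vector f ≡ vector g
vector-cong eq = mapT-≗ (eq ∘ Vec.lookup) (states _)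

Table : Set
Table = Tree (List (List Bool))

-- The matrix of `o` in sparse form: for each state, the paths to its one or two successors.
table : ∀ {k} → Op k → Table
table {k} o = mapT (map (locate 0 [] ∘ canonical) ∘ successors o ∘ Vec.lookup) (states k)

-- A decidable condition in place of a planarity argument: if a successor of a listed state were
-- crossing, its path would end at another state and the equation would fail.
Located : ∀ {k} → Op k → Set
Located {k} o =
  Everywhere (λ v → All (λ κ → at (locate 0 [] (canonical κ)) (states k) ≡ canonical κ)
  (successors o (Vec.lookup v))) (states k)

located? : ∀ {k} (o : Op k) → Dec (Located o)
located? {k} o = everywhere? (λ v → All.all? (λ κ → Vec.≡-dec ℕ._≟_ _ _) _) (states k)

apply : Table → Tree ℤ → Tree ℤ
apply t x = mapT (sumOver (λ p → at p x)) t

applyAll : List Table → Tree ℤ → Tree ℤ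
applyAll ts x = foldr apply x ts

apply-vector : ∀ (o : Op k) {f} → Located o → Invariant f →
               apply (table o) (vector f) ≡ vector (run (o ∷ []) f)
apply-vector {k} o {f} located inv = trans (mapT-∘ _ _ (states k)) (mapT-cong (states k)
  (everywhere-map (λ v → entries {successors o (Vec.lookup v)}) (states k) located))
  where
  entry : ∀ κ → at (locate 0 [] (canonical κ)) (states k) ≡ canonical κ →
          at (locate 0 [] (canonical κ)) (vector f) ≡ f κ
  entry κ eq = trans (at-mapT (f ∘ Vec.lookup) (locate 0 [] (canonical κ)) (states k))
    (trans (cong (f ∘ Vec.lookup) eq) (sym (inv (canonical-≋ κ))))

  entries : ∀ {κs} → All (λ κ → at (locate 0 [] (canonical κ)) (states k) ≡ canonical κ) κs →
    sumOver (λ p → at p (vector f)) (map (locate 0 [] ∘ canonical) κs) ≡ sumOver f κs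
  entries {[]}     []       = refl
  entries {κ ∷ κs} (e ∷ es) = cong₂ _+_ (entry κ e) (entries es)

applyAll-vector : ∀ {p : List (Op k)} {f} → All Located p → Invariant f →
                  applyAll (map table p) (vector f) ≡ vector (run p f)
applyAll-vector []                          inv = refl
applyAll-vector {p = o ∷ p} (located ∷ all) inv =
  trans (cong (apply (table o)) (applyAll-vector all inv)) (apply-vector o located (run-≋ p inv))

trajectory : List Table → ℕ → Tree ℤ → List (Tree ℤ)
trajectory ts zero    x = []
trajectory ts (suc n) x = x ∷ trajectory ts n (applyAll ts x)

-- The parameter `k` gives the final zero vector the shape of `states k`, so that on vectors of this
-- shape `zipT` does not meet its default clause.
linearCombination : ∀ k → List ℤ → List (Tree ℤ) → Tree ℤ
linearCombination k (c ∷ cs) (x ∷ xs) = zipT (λ a b → c * a + b) x (linearCombination k cs xs)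
linearCombination k _        _        = vector {k} (const (+ 0))

module _ {p : List (Op k)} (located : All Located p) {F : ℕ → (Fin k → ℕ) → ℤ} (O : Orbit p F) where

  private
    ts = map table p

    advance : ∀ m → applyAll ts (vector (F m)) ≡ vector (F (suc m))
    advance m = trans (applyAll-vector located (invariant O m)) (vector-cong (step O m))

  linearCombination-trajectory : ∀ cs m →
    linearCombination k cs (trajectory ts (length cs) (vector (F m))) ≡
                                vector (windows cs F m)
  linearCombination-trajectory []       m = refl
  linearCombination-trajectory (c ∷ cs) m = begin
    zipT op (vector (F m))
      (linearCombination k cs (trajectory ts (length cs) (applyAll ts (vector (F m)))))
      ≡⟨ cong (λ x →
        zipT op (vector (F m)) (linearCombination k cs (trajectory ts (length cs) x))) (advance m) ⟩
    zipT op (vector (F m)) (linearCombination k cs (trajectory ts (length cs) (vector (F (suc m)))))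
      ≡⟨ cong (zipT op (vector (F m))) (linearCombination-trajectory cs (suc m)) ⟩
    zipT op (vector (F m)) (vector (windows cs F (suc m)))
      ≡⟨ zipT-mapT op (F m ∘ Vec.lookup) _ (states k) ⟩
    vector (windows (c ∷ cs) F m)
      ∎
    where
    open ≡-Reasoning
    op = λ a b → c * a + b

  -- `polynomial` serves as indexing of a list with default zero.
  at-trajectory : ∀ q n m i → i < n →
    polynomial (map (at q) (trajectory ts n (vector (F m)))) i ≡ F (m ℕ.+ i)
      (Vec.lookup (at q (states k)))
  at-trajectory q (suc n) m zero    _         =
    trans (at-mapT (F m ∘ Vec.lookup) q (states k)) (cong (λ l → F l _) (sym (ℕ.+-identityʳ m)))
  at-trajectory q (suc n) m (suc i) (s≤s i<n) = begin
    polynomial (map (at q) (trajectory ts n (applyAll ts (vector (F m))))) i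
      ≡⟨ cong (λ x → polynomial (map (at q) (trajectory ts n x)) i) (advance m) ⟩
    polynomial (map (at q) (trajectory ts n (vector (F (suc m))))) i
      ≡⟨ at-trajectory q n (suc m) i i<n ⟩
    F (suc m ℕ.+ i) (Vec.lookup (at q (states k)))
      ≡⟨ cong (λ l → F l (Vec.lookup (at q (states k)))) (ℕ.+-suc m i) ⟨
    F (m ℕ.+ suc i) (Vec.lookup (at q (states k)))
      ∎
    where open ≡-Reasoning

  -- `run` maps zero to zero, so one finite check settles all later vectors. The conclusion concerns
  -- listed states because a vector records the values at these only.
  vanishing : vector (F 0) ≡ mapT (const (+ 0)) (states k) → ∀ q m →
    F m (Vec.lookup (at q (states k))) ≡ + 0
  vanishing zero-at-0 q m =
    trans (sym (at-mapT (F m ∘ Vec.lookup) q (states k)))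
      (trans (cong (at q) (zeros m)) (at-mapT (const (+ 0)) q (states k)))
    where
    zeros : ∀ m → vector (F m) ≡ mapT (const (+ 0)) (states k)
    zeros zero    = zero-at-0
    zeros (suc m) = begin
      vector (F (suc m))                                     ≡⟨ advance m ⟨
      applyAll ts (vector (F m))                  ≡⟨ cong (applyAll ts) (zeros m) ⟩
      applyAll ts (vector {k} (const (+ 0)))                 ≡⟨ applyAll-vector located (λ _ → refl) ⟩
      vector (run p (const (+ 0)))                           ≡⟨ vector-cong (run-zero p) ⟩
      vector {k} (const (+ 0))                               ∎
      where open ≡-Reasoning

everywhere-const : ∀ {A B : Set} {c : B} (f : A → B) t → Everywhere (_≡ c) (mapT f t) →
  mapT f t ≡ mapT (const c) t
everywhere-const f (leaf x)   eq         = cong leaf eq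
everywhere-const f (node l r) (eq , eq′) =
  cong₂ node (everywhere-const f l eq) (everywhere-const f r eq′)

window-shift : ∀ cs {a b : ℕ → ℤ} → a ∘ suc ≗ b → ∀ m → window cs a (suc m) ≡ window cs b m
window-shift []       eq m = refl
window-shift (c ∷ cs) eq m = cong₂ (λ x y → c * x + y) (eq m) (window-shift cs eq (suc m))

polynomial-beyond : ∀ cs n → length cs ≤ n → polynomial cs n ≡ + 0
polynomial-beyond []       n       _         = refl
polynomial-beyond (c ∷ cs) (suc n) (s≤s len) = polynomial-beyond cs n len

-- The finite certificate and the recurrence drawn from it

module Certificate (k : ℕ) (origin : List Bool) (den num qs : List ℤ) where

  characteristic annihilator : List ℤ
  characteristic = reverse den
  annihilator    = qs ++ + 1 ∷ []

  -- Below `length den` the coefficients are compared one by one; from there on the recurrence takes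
  -- over. The leading `+ 0` is the term for zero columns.
  InitialTerms : List (Tree ℤ) → Set
  InitialTerms xs =
    All (λ n → (polynomial den ⊛ polynomial (+ 0 ∷ map (at origin) xs)) n ≡ polynomial num n)
        (upTo (length den))

  initialTerms? : ∀ xs → Dec (InitialTerms xs)
  initialTerms? xs = All.all? (λ n → _ ℤ.≟ _) (upTo (length den))

  Annihilated : List (Tree ℤ) → Set
  Annihilated ys = All (λ n → polynomial (map (at origin) ys) n ≡ + 0) (upTo (length qs)) ×
                   Everywhere (_≡ + 0) (linearCombination k annihilator ys)

  annihilated? : ∀ ys → Dec (Annihilated ys)
  annihilated? ys = All.all? (λ n → _ ℤ.≟ + 0) (upTo (length qs)) ×-dec
                    everywhere? (ℤ._≟ + 0) (linearCombination k annihilator ys)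

  Checked : List Table → List (Tree ℤ) → Set
  Checked ts xs =
    InitialTerms xs ×
    Annihilated (trajectory ts (length annihilator) (linearCombination k characteristic xs))

  -- The tables and the trajectory are arguments so that they are evaluated only once.
  checked? : ∀ ts xs → Dec (Checked ts xs)
  checked? ts xs =
    initialTerms? xs ×-dec
    annihilated? (trajectory ts (length annihilator) (linearCombination k characteristic xs))

  -- A record rather than a synonym: comparing two instances must not run the computation.
  record Certified (ts : List Table) (x : Tree ℤ) : Set where
    constructor certify
    field
      checked : Checked ts (trajectory ts (length characteristic) x)

  certified? : ∀ ts x → Dec (Certified ts x)
  certified? ts x =
    map′ certify Certified.checked (checked? ts (trajectory ts (length characteristic) x))

module _ {k : ℕ} {p : List (Op k)} (located : All Located p)
  {F : ℕ → (Fin k → ℕ) → ℤ} (O : Orbit p F)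
  (p₀ : List (Op k)) {f₀ : (Fin k → ℕ) → ℤ} (inv₀ : Invariant f₀)
  (located₀ : All Located p₀) (start : run p₀ f₀ ≗ F 0)
  (origin : List Bool) (den num qs : List ℤ) (short : length num ≤ length den) where

  open Certificate k origin den num qs

  private
    κ  = Vec.lookup (at origin (states k))
    ts = map table p
    E  = windows characteristic F
    OE = windows-orbit characteristic O

  initial-vector : applyAll (map table p₀) (vector f₀) ≡ vector (F 0)
  initial-vector = trans (applyAll-vector located₀ inv₀) (vector-cong start)

  -- The combination of the orbit `E` by `annihilator` is an orbit that starts at zero, hence
  -- vanishes throughout. Read at `origin`, this is a monic recurrence of order `length qs` for the
  -- single sequence `E m κ`.
  annihilated : Annihilated (trajectory ts (length annihilator) (vector (E 0))) → ∀ m → E m κ ≡ + 0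
  annihilated (initial , zero-vector) = monic-recurrence-zero qs (λ m → E m κ)
    (vanishing located (windows-orbit annihilator OE)
      (everywhere-const _ (states k)
        (subst (Everywhere (_≡ + 0))
          (linearCombination-trajectory located OE annihilator 0) zero-vector))
      origin)
    λ m m< → trans
      (sym (at-trajectory located OE origin (length annihilator) 0 m
        (ℕ.<-≤-trans m< (ℕ.≤-trans (ℕ.m≤m+n (length qs) 1) (ℕ.≤-reflexive (sym (length-++ qs)))))))
      (All.lookup initial (∈-upTo⁺ m<))

  certified⇒recurrence : Certified ts (applyAll (map table p₀) (vector f₀)) →
    ∀ a → a 0 ≡ + 0 → (∀ m → a (suc m) ≡ F m κ) → polynomial den ⊛ a ≗ polynomial num
  certified⇒recurrence (certify checked) a a₀≡0 a≡F n
    with checked′ ← subst (Checked ts ∘ trajectory ts (length characteristic)) initial-vector checked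
       | n ℕ.<? length den
  ... | yes n< = trans
    (⊛-cong-≤ (polynomial den) _ a _ n (λ _ _ → refl) λ m m≤n → sym (agrees m (ℕ.≤-<-trans m≤n n<)))
    (All.lookup (proj₁ checked′) (∈-upTo⁺ n<))
    where
    xs = trajectory ts (length characteristic) (vector (F 0))

    agrees : ∀ m → m < length den → polynomial (+ 0 ∷ map (at origin) xs) m ≡ a m
    agrees zero    _  = sym a₀≡0
    agrees (suc m) m< = trans
      (at-trajectory located O origin (length characteristic) 0 m
        (ℕ.≤-trans (ℕ.<⇒≤ m<) (ℕ.≤-reflexive (sym (length-reverse den)))))
      (sym (a≡F m))
  -- Here `short` makes the coefficient of the numerator zero. The window starts at `suc m`, as
  -- `length den` exceeds the formal degree by one; this cancels the shift between `a` and `F`.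
  ... | no n≮ with m , refl ← ℕ.m≤n⇒∃[o]m+o≡n (ℕ.≮⇒≥ n≮) = begin
    (polynomial den ⊛ a) (length den ℕ.+ m)
      ≡⟨ polynomial-⊛-beyond den a m ⟩
    window characteristic a (suc m)
      ≡⟨ window-shift characteristic a≡F m ⟩
    E m κ
      ≡⟨ annihilated (subst (Annihilated ∘ trajectory ts (length annihilator))
           combine-characteristic (proj₂ checked′)) m ⟩
    + 0
      ≡⟨ polynomial-beyond num _ (ℕ.≤-trans short (ℕ.m≤m+n (length den) m)) ⟨
    polynomial num (length den ℕ.+ m)
      ∎
    where
    open ≡-Reasoning

    combine-characteristic : linearCombination k characteristic
      (trajectory ts (length characteristic) (vector (F 0))) ≡ vector (E 0)
    combine-characteristic = linearCombination-trajectory located O characteristic 0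

-- The recurrence for seven rows

period : List (Op 7)
period = joins ++ shiftAll

period-orbit : Orbit period (value ∘ columns)
period-orbit = record
  { invariant = λ m → value-≋ (columns m)
  -- `period ++ columns m` computes to `columns (suc m)`, since `joins` and `shiftAll` are closed
  -- lists.
  ; step      = λ m κ → sym (run-++ period (columns m) _ κ)
  }

period-located : All Located period
period-located = toWitness {a? = All.all? located? period} _

joins-located : All Located joins
joins-located = toWitness {a? = All.all? located? joins} _

discrete : List Bool
discrete = locate 0 [] (canonical {7} toℕ)

at-discrete : at discrete (states 7) ≡ canonical toℕ
at-discrete = refl

-- As a sequence of vectors, the values satisfy a longer recurrence than their entry
-- at the discrete partition: the minimal polynomial of the vectors is D₇ times
-- t⁸ + Σᵢ cofactorᵢ tⁱ (found by linear algebra).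
cofactor : List ℤ
cofactor = + 1 ∷ - (+ 71) ∷ + 952 ∷ - (+ 3976) ∷ + 6384 ∷ - (+ 3976) ∷ + 952 ∷ - (+ 71) ∷ []

open Certificate 7 discrete D₇ N₇ cofactor

certificate : Certified (map table period)
  (applyAll (map table joins) (vector (indicator ∘ agree? (allFin 7))))
certificate = toWitness {a? = certified? _ _} _

s-discrete : ∀ m → + s 7 (suc m) ≡ value (columns m) (Vec.lookup (at discrete (states 7)))
s-discrete m = trans (s-value m) (value-≋ (columns m)
  (subst (λ v → toℕ ≋ Vec.lookup v) (sym at-discrete) (canonical-≋ toℕ)))

recurrence : polynomial D₇ ⊛ (λ n → + s 7 n) ≗ polynomial N₇
recurrence = certified⇒recurrence period-located period-orbit joins
  (agree-invariant (allFin 7)) joins-located (λ _ → refl) discrete D₇ N₇ cofactor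
  -- `N₇` has 48 coefficients and `D₇` has 49.
  (ℕ.n≤1+n 48) certificate (λ n → + s 7 n) refl s-discrete

theorem7 : (λ n → + s 7 n) ≈ polynomial N₇ / polynomial D₇
theorem7 = fraction (polynomial D₇) refl {λ n → + s 7 n} {polynomial N₇} recurrence
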